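{- Let $E$ and $F$ be finite sets and let $\mathsf{A}$ be a bimatroid on the ground set $E\times F$. Set $m=|E|$, $n=|F|$ and $m\wedge n=\min\{m,n\}$. For $k\geq 0$ let $R_k(\mathsf{A})$ denote the number of regular minors $(I,J)$ of $\mathsf{A}$ with $|I|=|J|=k$. Then the sequence $R_k(\mathsf{A})$ is ultra log-concave, i.e. \[ \frac{R_k(\mathsf{A})^2}{\binom{m\wedge n}{k}^2}\geq \frac{R_{k+1}(\mathsf{A})}{\binom{m\wedge n}{k+1}}\cdot \frac{R_{k-1}(\mathsf{A})}{\binom{m\wedge n}{k-1}} \] for all $k\geq 1$.
   Context: For finite sets $E,F$ write $\binom{E}{\ast}\times\binom{F}{\ast}=\bigcup_{d\ge 0}\binom{E}{d}\times\binom{F}{d}$, where $\binom{S}{d}$ is the set of $d$-element subsets of $S$. For sets $S$ and $s\in S$, $s'\notin S$, write $S_{s\leftrightarrow s'}=(S-\{s\})\cup\{s'\}$. A bimatroid $\mathsf{A}$ on $E\times F$ is a subset $\mathcal{R}(\mathsf{A})\subseteq\binom{E}{\ast}\times\binom{F}{\ast}$ (the regular minors) such that: (1) $(\emptyset,\emptyset)\in\mathcal{R}(\mathsf{A})$; (2) for all $(I,J),(I',J')\in\mathcal{R}(\mathsf{A})$: (a) for every $i'\in I'-I$, either there is $i\in I-I'$ with $(I_{i\leftrightarrow i'},J)\in\mathcal{R}(\mathsf{A})$, or there is $j'\in J'-J$ with $(I\cup\{i'\},J\cup\{j'\})\in\mathcal{R}(\mathsf{A})$; (b) for every $j\in J-J'$,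 either there is $j'\in J'-J$ with $(I,J_{j\leftrightarrow j'})\in\mathcal{R}(\mathsf{A})$, or there is $i\in I-I'$ with $(I-\{i\},J-\{j\})\in\mathcal{R}(\mathsf{A})$. (Example: the pairs $(I,J)$ with $\det A_{I,J}\neq 0$ for a matrix $A\in\mathbb{K}^{E\times F}$.) -}

module Defs where

open import Data.Bool using (Bool; true; false; T; if_then_else_)
open import Data.Nat using (ℕ; zero; suc; _⊓_; _*_; _≡ᵇ_)
open import Data.Nat.Combinatorics using (_C_)
open import Data.List using (List; []; _∷_; map; _++_; concatMap; filter; length)
open import Data.Vec using (Vec; []; _∷_)
open import Data.Fin using (Fin)
open import Data.Fin.Subset using (Subset; ⊥; ⁅_⁆; _∈_; _∉_; _∪_; _-_; ∣_∣; inside; outside)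
open import Data.Product using (Σ; _×_; _,_; ∃-syntax)
open import Data.Sum using (_⊎_)
open import Relation.Binary.PropositionalEquality using (_≡_)
open import Relation.Nullary.Decidable using (does)
open import Data.Bool.Properties using (T?)

-- A bimatroid on Fin m × Fin n (E = Fin m, F = Fin n).
-- The set of regular minors is given by its (Boolean) characteristic function.
record Bimatroid (m n : ℕ) : Set where
  field
    R : Subset m → Subset n → Bool
    sameSize : ∀ I J → T (R I J) → ∣ I ∣ ≡ ∣ J ∣
    emptyRegular : T (R ⊥ ⊥)
    exchangeRow : ∀ I J I' J' → T (R I J) → T (R I' J') →
      ∀ i' → i' ∈ I' → i' ∉ I →
        (∃[ i ] (i ∈ I × i ∉ I' × T (R ((I - i) ∪ ⁅ i' ⁆) J)))
        ⊎ (∃[ j' ] (j' ∈ J' × j' ∉ J × T (R (I ∪ ⁅ i' ⁆) (J ∪ ⁅ j' ⁆))))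
    exchangeCol : ∀ I J I' J' → T (R I J) → T (R I' J') →
      ∀ j → j ∈ J → j ∉ J' →
        (∃[ j' ] (j' ∈ J' × j' ∉ J × T (R I ((J - j) ∪ ⁅ j' ⁆))))
        ⊎ (∃[ i ] (i ∈ I × i ∉ I' × T (R (I - i) (J - j))))

allSubsets : (n : ℕ) → List (Subset n)
allSubsets zero = [] ∷ []
allSubsets (suc n) = map (inside ∷_) (allSubsets n) ++ map (outside ∷_) (allSubsets n)

regularCount : ∀ {m n} → Bimatroid m n → ℕ → ℕ
regularCount {m} {n} A k =
  length (filter (λ p → T? (Bimatroid.R A (Data.Product.proj₁ p) (Data.Product.proj₂ p)
                          ∧ₜ ((∣ Data.Product.proj₁ p ∣ ≡ᵇ k) ∧ₜ (∣ Data.Product.proj₂ p ∣ ≡ᵇ k))))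
    (concatMap (λ I → map (I ,_) (allSubsets n)) (allSubsets m)))
  where
    _∧ₜ_ : Bool → Bool → Bool
    true ∧ₜ b = b
    false ∧ₜ b = false

{-# OPTIONS --safe #-}

-- Through I ∪ (F ∖ J), or (E ∖ I) ∪ J, regular minors become bases of a matroid on E ⊔ F of rank |F|, or |E|; use the
-- smaller rank d. The polarized basis generating polynomial F(z₁, …, z_d) = ∑ z₁(x₁) ⋯ z_d(x_d), over ordered bases,
-- takes the value k! (d - k)! R_k on k copies of one indicator vector and d - k of the other, so ultra log-concavity
-- is the Alexandrov–Fenchel inequality F(x,x,zs) F(y,y,zs) ≤ F(x,y,zs)² for nonnegative vectors.
-- For positive vectors it is proved by induction on d with the Bochner method of Shenfeld and van Handel. The form
-- F(·,·,w,zs) is the w-average of the forms of the contractions; applying the inequality to these gives ⟨v,Av⟩ ≤ ⟨Av,Av⟩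
-- for a reversible Markov operator A. By basis exchange A² has positive entries between nonloops, hence A² ≤ 1 - 1/m on
-- mean-zero vectors, and iterating ⟨v,Av⟩ ≤ ⟨Av,Av⟩ pushes the bound on A down to 0 there without any eigenvalues.
-- In rank 2 the form is a square minus a sum of squares over parallel classes.
module Submission where

open import Algebra.Bundles using (CommutativeRing)
open import Algebra.Solver.Ring.AlmostCommutativeRing using (_-Raw-AlmostCommutative⟶_; fromCommutativeRing)
open import Algebra.Structures using (IsCommutativeRing)
open import Data.Bool using (Bool; true; false; if_then_else_; not; _∧_; T)
import Data.Bool.Properties as Bool
open import Data.Empty using (⊥-elim)
open import Data.Fin using (Fin; zero; suc)
import Data.Fin.Properties as Fin
open import Data.Fin.Subset as Subset using (Subset; ⁅_⁆; _∪_; ∁; ∣_∣)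
import Data.Fin.Subset.Properties as Subset
import Data.Integer as ℤ
import Data.Integer.Properties as ℤ
open import Data.List using (List; []; _∷_; _++_; length; map; allFin; concatMap; filter; replicate)
open import Data.List.Membership.Propositional using (_∈_; _∉_; find; lose)
open import Data.List.Membership.Propositional.Properties using (∈-∃++; ∈-++⁺ˡ; ∈-++⁺ʳ; ∈-map⁺; ∈-allFin)
open import Data.List.Properties using (map-tabulate)
open import Data.List.Relation.Binary.Permutation.Propositional as ↭ using (_↭_; prep; swap; ↭-refl; ↭-trans; ↭-sym)
open import Data.List.Relation.Binary.Permutation.Propositional.Properties using (↭-length; ∈-resp-↭; drop-∷) renaming (shift to ↭-shift)
open import Data.List.Relation.Unary.All using (All; []; _∷_)
open import Data.List.Relation.Unary.Any using (here; there; any?)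
open import Data.Nat as ℕ using (ℕ; zero; suc; _≡ᵇ_; _!)
open import Data.Nat.Combinatorics using (nCk≡n!/k![n-k]!; k![n∸k]!∣n!)
import Data.Nat.DivMod as ℕ
import Data.Nat.Properties as ℕ
open import Data.Nat.Solver using (module +-*-Solver)
open import Data.Product using (Σ; ∃-syntax; _×_; _,_; proj₁; proj₂)
open import Data.Rational as ℚ using (ℚ; 0ℚ; 1ℚ; _≤_; _<_; mkℚ)
import Data.Rational.Properties as ℚ
open import Data.Rational.Unnormalised as ℚᵘ using (mkℚᵘ; *≡*)
import Data.Rational.Unnormalised.Properties as ℚᵘ
open import Data.Sum using (_⊎_; inj₁; inj₂; [_,_]′)
import Data.Sum.Properties as Sum
open import Data.Vec as Vec using (Vec; []; _∷_; lookup; _[_]≔_)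
import Data.Vec.Properties as Vec
open import Function using (_∘_; case_of_; id)
open import Level using (0ℓ)
open import Relation.Binary.Consequences using (dec⇒weaklyDec)
open import Relation.Binary.Definitions using (DecidableEquality; tri<; tri≈; tri>)
open import Relation.Binary.PropositionalEquality
open import Relation.Nullary using (yes; no; does)
open import Relation.Nullary.Decidable using (dec-true)
open import Relation.Unary using (Pred; Decidable)

open import Defs

-- Arithmetic in ℚ

-- Spectrally, ⟨v,Av⟩ ≤ ⟨Av,Av⟩ confines each eigenvalue λ of A to λ ≤ 0 or λ ≥ 1, and the gap of A²
-- excludes λ ≥ 1 on mean-zero vectors. So the form has at most one positive direction, which is
-- what the inequality expresses. Over ℚ eigenvectors need not exist; moments ⟨Aⁱv,v⟩ replace them.
-- The gap is sought for A² because A has zero diagonal and vanishes between parallel elements. Even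
-- A² has a gap only from rank 3 on: in rank 2 with exactly two parallel classes the chain is
-- bipartite and -1 is an eigenvalue of A on mean-zero vectors. Hence rank 2 is a separate base
-- case. Strictly positive vectors let the support of the form depend on the matroid alone and
-- permit division by w; indicator vectors are reached afterwards by perturbation. The smaller rank
-- is chosen because rank d yields the inequality with the binomials of d, which is stronger for
-- smaller d.

module OrderedField where
  infixl 6 _+_ _-_
  infixl 7 _*_
  infix 8 -_

  -- The field operations of ℚ compute by normalising fractions even on variables; sealing them keeps conversion checking cheap.
  opaque
    _+_ _*_ : ℚ → ℚ → ℚ
    _+_ = ℚ._+_
    _*_ = ℚ._*_

    -_ : ℚ → ℚ
    -_ = ℚ.-_

    isCommutativeRing : IsCommutativeRing _≡_ _+_ _*_ -_ 0ℚ 1ℚ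
    isCommutativeRing = ℚ.+-*-isCommutativeRing

  _-_ : ℚ → ℚ → ℚ
  a - b = a + - b

  commutativeRing : CommutativeRing 0ℓ 0ℓ
  commutativeRing = record { isCommutativeRing = isCommutativeRing }

  open CommutativeRing commutativeRing public
    using (+-identityˡ; +-identityʳ; *-identityˡ; *-identityʳ; zeroˡ; zeroʳ; distribˡ; distribʳ; +-comm; *-comm; +-assoc; *-assoc)

  opaque
    unfolding _+_

    +-sealed : ∀ a b → a ℚ.+ b ≡ a + b
    +-sealed a b = refl

    *-sealed : ∀ a b → a ℚ.* b ≡ a * b
    *-sealed a b = refl

    neg-sealed : ∀ a → ℚ.- a ≡ - a
    neg-sealed a = refl

    +-mono-≤ : ∀ {a b c d} → a ≤ b → c ≤ d → a + c ≤ b + d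
    +-mono-≤ = ℚ.+-mono-≤

    *-monoˡ-≤ : ∀ {a b} c → 0ℚ ≤ c → a ≤ b → c * a ≤ c * b
    *-monoˡ-≤ c 0≤c = ℚ.*-monoˡ-≤-nonNeg c {{ℚ.nonNegative 0≤c}}

    *-cancelˡ-≤ : ∀ {a b} c → 0ℚ < c → c * a ≤ c * b → a ≤ b
    *-cancelˡ-≤ c 0<c = ℚ.*-cancelˡ-≤-pos c {{ℚ.positive 0<c}}

    *-pos : ∀ {a b} → 0ℚ < a → 0ℚ < b → 0ℚ < a * b
    *-pos {a} {b} 0<a 0<b =
      ℚ.positive⁻¹ (a ℚ.* b) {{ℚ.pos*pos⇒pos a {{ℚ.positive 0<a}} b {{ℚ.positive 0<b}}}}

    reciprocal : ∀ a → 0ℚ < a → ∃[ r ] (0ℚ < r × a * r ≡ 1ℚ)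
    reciprocal a 0<a = (ℚ.1/ a) {{a≢0}} , ℚ.positive⁻¹ ((ℚ.1/ a) {{a≢0}}) {{ℚ.1/pos⇒pos a {{a>0}}}} , ℚ.*-inverseʳ a {{a≢0}}
      where
      a>0 : ℚ.Positive a
      a>0 = ℚ.positive 0<a

      a≢0 : ℚ.NonZero a
      a≢0 = ℚ.pos⇒nonZero a {{a>0}}

  sealed : CommutativeRing.rawRing ℚ.+-*-commutativeRing -Raw-AlmostCommutative⟶ fromCommutativeRing commutativeRing
  sealed = record
    { ⟦_⟧ = λ x → x ; +-homo = +-sealed ; *-homo = *-sealed ; -‿homo = neg-sealed
    ; 0-homo = refl ; 1-homo = refl }

  open import Algebra.Solver.Ring (CommutativeRing.rawRing ℚ.+-*-commutativeRing)
    (fromCommutativeRing commutativeRing) sealed (dec⇒weaklyDec ℚ._≟_) public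
    using (solve; _:=_; _:+_; _:*_; _:-_; :-_; con)

  open import Data.Rational.Properties public using (≤-refl; ≤-trans; ≤-antisym; ≤-total; ≤-reflexive; <⇒≤; <-≤-trans; <-irrefl; <-cmp)

  +-nonneg : ∀ {a b} → 0ℚ ≤ a → 0ℚ ≤ b → 0ℚ ≤ a + b
  +-nonneg {a} {b} 0≤a 0≤b = subst (_≤ a + b) (+-identityˡ 0ℚ) (+-mono-≤ 0≤a 0≤b)

  *-nonneg : ∀ {a b} → 0ℚ ≤ a → 0ℚ ≤ b → 0ℚ ≤ a * b
  *-nonneg {a} {b} 0≤a 0≤b = subst (_≤ a * b) (zeroʳ a) (*-monoˡ-≤ a 0≤a 0≤b)

  *-mono-≤ : ∀ {a b c d} → 0ℚ ≤ a → 0ℚ ≤ d → a ≤ b → c ≤ d → a * c ≤ b * d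
  *-mono-≤ {a} {b} {c} {d} 0≤a 0≤d a≤b c≤d =
    ≤-trans (*-monoˡ-≤ a 0≤a c≤d) (subst₂ _≤_ (*-comm d a) (*-comm d b) (*-monoˡ-≤ d 0≤d a≤b))

  p≤p+q : ∀ {a b c} → 0ℚ ≤ c → b ≡ a + c → a ≤ b
  p≤p+q {a} {_} {c} 0≤c refl = subst (_≤ a + c) (+-identityʳ a) (+-mono-≤ (≤-refl {a}) 0≤c)

  difference-nonneg : ∀ {a b} → a ≤ b → 0ℚ ≤ b - a
  difference-nonneg {a} {b} a≤b =
    subst (_≤ b - a) (solve 1 (λ a → a :- a := con 0ℚ) refl a) (+-mono-≤ a≤b (≤-refl { - a}))

  +-cancelʳ-≤ : ∀ {a b} c → a + c ≤ b + c → a ≤ b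
  +-cancelʳ-≤ {a} {b} c le = p≤p+q (difference-nonneg le)
    (solve 3 (λ a b c → b := a :+ ((b :+ c) :- (a :+ c))) refl a b c)

  sq-nonneg : ∀ a → 0ℚ ≤ a * a
  sq-nonneg a with ≤-total 0ℚ a
  ... | inj₁ 0≤a = *-nonneg 0≤a 0≤a
  ... | inj₂ a≤0 = subst (0ℚ ≤_) (solve 1 (λ a → (con 0ℚ :- a) :* (con 0ℚ :- a) := a :* a) refl a)
                     (*-nonneg (difference-nonneg a≤0) (difference-nonneg a≤0))

  nonneg-cases : ∀ {a} → 0ℚ ≤ a → a ≡ 0ℚ ⊎ 0ℚ < a
  nonneg-cases {a} 0≤a with <-cmp 0ℚ a
  ... | tri< 0<a _ _ = inj₂ 0<a
  ... | tri≈ _ 0≡a _ = inj₁ (sym 0≡a)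
  ... | tri> _ _ a<0 = ⊥-elim (<-irrefl refl (<-≤-trans a<0 0≤a))

  +-pos : ∀ {a b} → 0ℚ < a → 0ℚ ≤ b → 0ℚ < a + b
  +-pos 0<a 0≤b = <-≤-trans 0<a (p≤p+q 0≤b refl)

  0<1 : 0ℚ < 1ℚ
  0<1 = ℚ.positive⁻¹ 1ℚ {{_}}

  -- Total, with value 0 off the positive numbers, so that it can occur in the definition of an
  -- operator some of whose weights vanish.
  recip : ℚ → ℚ
  recip a with <-cmp 0ℚ a
  ... | tri< 0<a _ _ = proj₁ (reciprocal a 0<a)
  ... | _ = 0ℚ

  recip-nonneg : ∀ a → 0ℚ ≤ recip a
  recip-nonneg a with <-cmp 0ℚ a
  ... | tri< 0<a _ _ = <⇒≤ (proj₁ (proj₂ (reciprocal a 0<a)))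
  ... | tri≈ _ _ _ = ≤-refl
  ... | tri> _ _ _ = ≤-refl

  recip-inverse : ∀ {a} → 0ℚ < a → a * recip a ≡ 1ℚ
  recip-inverse {a} 0<a with <-cmp 0ℚ a
  ... | tri< 0<a′ _ _ = proj₂ (proj₂ (reciprocal a 0<a′))
  ... | tri≈ 0≮a _ _ = ⊥-elim (0≮a 0<a)
  ... | tri> 0≮a _ _ = ⊥-elim (0≮a 0<a)

  recip-pos : ∀ {a} → 0ℚ < a → 0ℚ < recip a
  recip-pos {a} 0<a with nonneg-cases (recip-nonneg a)
  ... | inj₂ 0<r = 0<r
  ... | inj₁ r≡0 = ⊥-elim (<-irrefl (trans (sym (zeroʳ a)) (trans (cong (a *_) (sym r≡0)) (recip-inverse 0<a))) 0<1)

  indicator : Bool → ℚ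
  indicator b = if b then 1ℚ else 0ℚ

  indicator-nonneg : ∀ b → 0ℚ ≤ indicator b
  indicator-nonneg true = <⇒≤ 0<1
  indicator-nonneg false = ≤-refl {0ℚ}

  fromℕ : ℕ → ℚ
  fromℕ zero = 0ℚ
  fromℕ (suc n) = 1ℚ + fromℕ n

  fromℕ-nonneg : ∀ n → 0ℚ ≤ fromℕ n
  fromℕ-nonneg zero = ≤-refl {0ℚ}
  fromℕ-nonneg (suc n) = +-nonneg (<⇒≤ 0<1) (fromℕ-nonneg n)

  fromℕ-+ : ∀ m n → fromℕ (m ℕ.+ n) ≡ fromℕ m + fromℕ n
  fromℕ-+ zero n = sym (+-identityˡ _)
  fromℕ-+ (suc m) n = trans (cong (1ℚ +_) (fromℕ-+ m n)) (sym (+-assoc _ _ _))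

  fromℕ-* : ∀ m n → fromℕ (m ℕ.* n) ≡ fromℕ m * fromℕ n
  fromℕ-* zero n = sym (zeroˡ _)
  fromℕ-* (suc m) n = trans (fromℕ-+ n (m ℕ.* n)) (trans (cong (_ +_) (fromℕ-* m n))
    (solve 2 (λ m n → n :+ m :* n := (con 1ℚ :+ m) :* n) refl (fromℕ m) (fromℕ n)))

  fromℕ-mono-≤ : ∀ {m n} → m ℕ.≤ n → fromℕ m ≤ fromℕ n
  fromℕ-mono-≤ {n = n} ℕ.z≤n = fromℕ-nonneg n
  fromℕ-mono-≤ (ℕ.s≤s m≤n) = +-mono-≤ ≤-refl (fromℕ-mono-≤ m≤n)

  fromℕ-pos : ∀ n → 0ℚ < fromℕ (suc n)
  fromℕ-pos n = +-pos 0<1 (fromℕ-nonneg n)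

  fromℕ-cancel-≤ : ∀ m n → fromℕ m ≤ fromℕ n → m ℕ.≤ n
  fromℕ-cancel-≤ zero n _ = ℕ.z≤n
  fromℕ-cancel-≤ (suc m) zero le = ⊥-elim (<-irrefl refl (<-≤-trans (fromℕ-pos m) le))
  fromℕ-cancel-≤ (suc m) (suc n) le =
    ℕ.s≤s (fromℕ-cancel-≤ m n (+-cancelʳ-≤ 1ℚ (subst₂ _≤_ (+-comm 1ℚ _) (+-comm 1ℚ _) le)))

  opaque
    unfolding _+_

    toℚᵘ-fromℕ : ∀ n → ℚ.toℚᵘ (fromℕ n) ℚᵘ.≃ mkℚᵘ (ℤ.+ n) 0
    toℚᵘ-fromℕ zero = *≡* refl
    toℚᵘ-fromℕ (suc n) = ℚᵘ.≃-trans (ℚ.toℚᵘ-homo-+ 1ℚ (fromℕ n))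
      (ℚᵘ.≃-trans (ℚᵘ.+-congʳ (ℚ.toℚᵘ 1ℚ) (toℚᵘ-fromℕ n))
        (*≡* (cong (λ k → (ℤ.1ℤ ℤ.+ k) ℤ.* ℤ.1ℤ) (ℤ.*-identityʳ (ℤ.+ n)))))

  -- The absolute value of the numerator suffices, as the denominator is at least 1. This turns
  -- positivity of a rational into an integer constant on which one can induct.
  archimedean : ∀ a → ∃[ n ] (a ≤ fromℕ n)
  archimedean a@(mkℚ p d-1 _) = ℤ.∣ p ∣ , ℚ.toℚᵘ-cancel-≤
    (ℚᵘ.≤-trans (ℚᵘ.*≤* bound) (ℚᵘ.≤-reflexive (ℚᵘ.≃-sym (toℚᵘ-fromℕ ℤ.∣ p ∣))))
    where
    i≤+∣i∣ : ∀ i → i ℤ.≤ ℤ.+ ℤ.∣ i ∣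
    i≤+∣i∣ (ℤ.+ n) = ℤ.≤-refl
    i≤+∣i∣ ℤ.-[1+ n ] = ℤ.-≤+

    bound : p ℤ.* ℤ.1ℤ ℤ.≤ (ℤ.+ ℤ.∣ p ∣) ℤ.* (ℤ.+ suc d-1)
    bound = ℤ.≤-trans (ℤ.≤-reflexive (ℤ.*-identityʳ p)) (ℤ.≤-trans (i≤+∣i∣ p)
      (ℤ.≤-trans (ℤ.+≤+ (ℕ.m≤m*n ℤ.∣ p ∣ (suc d-1) {{_}})) (ℤ.≤-reflexive (ℤ.pos-* ℤ.∣ p ∣ (suc d-1)))))

  -- If b < a, the bound fails at ε = (a - b) / ((a - b) + c + 1).
  ≤-limit : ∀ {a b c} → 0ℚ ≤ c → (∀ ε → 0ℚ < ε → ε ≤ 1ℚ → a ≤ b + ε * c) → a ≤ b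
  ≤-limit {a} {b} {c} 0≤c bound with <-cmp b a
  ... | tri≈ _ b≡a _ = ≤-reflexive (sym b≡a)
  ... | tri> _ _ a<b = <⇒≤ a<b
  ... | tri< b<a b≢a _ with nonneg-cases (difference-nonneg (<⇒≤ b<a))
  ...   | inj₁ d≡0 = ⊥-elim (b≢a (trans (sym (+-identityʳ b))
    (trans (cong (b +_) (sym d≡0)) (solve 2 (λ a b → b :+ (a :- b) := a) refl a b))))
  ...   | inj₂ 0<d = ⊥-elim (<-irrefl refl (<-≤-trans (*-pos 0<d (+-pos 0<d (<⇒≤ 0<1))) contradiction))
    where
    d = a - b
    s = d + (c + 1ℚ)

    0<s : 0ℚ < s
    0<s = +-pos 0<d (+-nonneg 0≤c (<⇒≤ 0<1))

    ρ = recip s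

    ε≤1 : d * ρ ≤ 1ℚ
    ε≤1 = subst (d * ρ ≤_) (recip-inverse 0<s)
      (*-mono-≤ (<⇒≤ 0<d) (recip-nonneg s) (p≤p+q (+-nonneg 0≤c (<⇒≤ 0<1)) refl) ≤-refl)

    -- The bound at ε = d ρ, multiplied by s, gives s d ≤ d c; since s = d + c + 1, what remains is
    -- d (d + 1) ≤ 0.
    contradiction : d * (d + 1ℚ) ≤ 0ℚ
    contradiction = +-cancelʳ-≤ (s * b + d * c) (subst₂ _≤_
      (solve 3 (λ a b c → (a :- b :+ (c :+ con 1ℚ)) :* a :=
        (a :- b) :* (a :- b :+ con 1ℚ) :+ ((a :- b :+ (c :+ con 1ℚ)) :* b :+ (a :- b) :* c)) refl a b c)
      (trans (solve 5 (λ s b d r c → s :* (b :+ d :* r :* c) := s :* b :+ s :* r :* (d :* c)) refl s b d ρ c)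
        (trans (cong (λ e → s * b + e * (d * c)) (recip-inverse 0<s))
          (solve 2 (λ x y → x :+ con 1ℚ :* y := con 0ℚ :+ (x :+ y)) refl (s * b) (d * c))))
      (*-monoˡ-≤ s (<⇒≤ 0<s) (bound (d * ρ) (*-pos 0<d (recip-pos 0<s)) ε≤1)))

-- Finite sums

module Summation where
  open OrderedField

  ∑ : ∀ {X : Set} → List X → (X → ℚ) → ℚ
  ∑ [] f = 0ℚ
  ∑ (x ∷ L) f = f x + ∑ L f

  module _ {X : Set} where
    ∑-cong : ∀ (L : List X) {f g} → (∀ x → f x ≡ g x) → ∑ L f ≡ ∑ L g
    ∑-cong [] eq = refl
    ∑-cong (x ∷ L) eq = cong₂ _+_ (eq x) (∑-cong L eq)

    ∑-zero : ∀ (L : List X) → ∑ L (λ _ → 0ℚ) ≡ 0ℚ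
    ∑-zero [] = refl
    ∑-zero (x ∷ L) = trans (+-identityˡ _) (∑-zero L)

    ∑-+ : ∀ (L : List X) f g → ∑ L (λ x → f x + g x) ≡ ∑ L f + ∑ L g
    ∑-+ [] f g = sym (+-identityˡ 0ℚ)
    ∑-+ (x ∷ L) f g = trans (cong (f x + g x +_) (∑-+ L f g))
      (solve 4 (λ a b c d → a :+ b :+ (c :+ d) := (a :+ c) :+ (b :+ d)) refl (f x) (g x) (∑ L f) (∑ L g))

    ∑-*ˡ : ∀ (L : List X) c f → ∑ L (λ x → c * f x) ≡ c * ∑ L f
    ∑-*ˡ [] c f = sym (zeroʳ c)
    ∑-*ˡ (x ∷ L) c f = trans (cong (c * f x +_) (∑-*ˡ L c f)) (sym (distribˡ c (f x) (∑ L f)))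

    ∑-*ʳ : ∀ (L : List X) c f → ∑ L (λ x → f x * c) ≡ ∑ L f * c
    ∑-*ʳ L c f = trans (∑-cong L (λ x → *-comm (f x) c)) (trans (∑-*ˡ L c f) (*-comm c _))

    ∑-++ : ∀ (K L : List X) f → ∑ (K ++ L) f ≡ ∑ K f + ∑ L f
    ∑-++ [] L f = sym (+-identityˡ _)
    ∑-++ (x ∷ K) L f = trans (cong (f x +_) (∑-++ K L f)) (sym (+-assoc _ _ _))

    ∑-map : ∀ {Y : Set} (h : Y → X) (L : List Y) f → ∑ (map h L) f ≡ ∑ L (f ∘ h)
    ∑-map h [] f = refl
    ∑-map h (x ∷ L) f = cong (f (h x) +_) (∑-map h L f)

    ∑-swap : ∀ {Y : Set} (L : List X) (K : List Y) (f : X → Y → ℚ) →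
      ∑ L (λ x → ∑ K (f x)) ≡ ∑ K (λ y → ∑ L (λ x → f x y))
    ∑-swap [] K f = sym (go K)
      where
      go : ∀ {Y : Set} (K : List Y) → ∑ K (λ _ → 0ℚ) ≡ 0ℚ
      go [] = refl
      go (_ ∷ K) = trans (+-identityˡ _) (go K)
    ∑-swap (x ∷ L) K f = trans (cong (∑ K (f x) +_) (∑-swap L K f)) (sym (go K))
      where
      go : ∀ K → ∑ K (λ y → f x y + ∑ L (λ x → f x y)) ≡ ∑ K (f x) + ∑ K (λ y → ∑ L (λ x → f x y))
      go [] = sym (+-identityˡ 0ℚ)
      go (y ∷ K) = trans (cong (f x y + ∑ L (λ x → f x y) +_) (go K))
        (solve 4 (λ a b c d → a :+ b :+ (c :+ d) := (a :+ c) :+ (b :+ d)) refl _ _ _ _)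

    ∑-mono : ∀ (L : List X) {f g} → (∀ x → f x ≤ g x) → ∑ L f ≤ ∑ L g
    ∑-mono [] le = ≤-refl {0ℚ}
    ∑-mono (x ∷ L) le = +-mono-≤ (le x) (∑-mono L le)

    ∑-nonneg : ∀ (L : List X) {f} → (∀ x → 0ℚ ≤ f x) → 0ℚ ≤ ∑ L f
    ∑-nonneg [] pos = ≤-refl {0ℚ}
    ∑-nonneg (x ∷ L) pos = +-nonneg (pos x) (∑-nonneg L pos)

    ∑-pos : ∀ {L : List X} {f x} → (∀ x → 0ℚ ≤ f x) → x ∈ L → 0ℚ < f x → 0ℚ < ∑ L f
    ∑-pos {y ∷ L} nn (here refl) 0<fx = +-pos 0<fx (∑-nonneg L nn)
    ∑-pos {y ∷ L} {f} nn (there x∈L) 0<fx =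
      subst (0ℚ <_) (+-comm _ (f y)) (+-pos (∑-pos nn x∈L 0<fx) (nn y))

    ∑-pos⁻¹ : ∀ (L : List X) {f} → (∀ x → 0ℚ ≤ f x) → 0ℚ < ∑ L f → ∃[ x ] (x ∈ L × 0ℚ < f x)
    ∑-pos⁻¹ [] nn 0<0 = ⊥-elim (<-irrefl refl 0<0)
    ∑-pos⁻¹ (x ∷ L) {f} nn 0<∑ with nonneg-cases (nn x)
    ... | inj₂ 0<fx = x , here refl , 0<fx
    ... | inj₁ fx≡0 with ∑-pos⁻¹ L nn (subst (0ℚ <_) (trans (cong (_+ ∑ L f) fx≡0) (+-identityˡ _)) 0<∑)
    ...   | y , y∈L , 0<fy = y , there y∈L , 0<fy

    ≤-∑ : ∀ {L : List X} {f x} → (∀ x → 0ℚ ≤ f x) → x ∈ L → f x ≤ ∑ L f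
    ≤-∑ {y ∷ L} nn (here refl) = p≤p+q (∑-nonneg L nn) refl
    ≤-∑ {y ∷ L} {f} nn (there x∈L) = ≤-trans (≤-∑ nn x∈L) (p≤p+q (nn y) (+-comm (f y) _))

  -- By monotonicity the maximum of the individual bounds works. It provides one Doeblin constant
  -- for all pairs of states.
  uniform-bound : ∀ {X : Set} {P : X → ℕ → Set} (L : List X) →
    (∀ {x m n} → m ℕ.≤ n → P x m → P x n) → (∀ x → ∃[ n ] P x n) → ∃[ n ] (∀ {x} → x ∈ L → P x n)
  uniform-bound [] mono ex = 0 , λ ()
  uniform-bound (x ∷ L) mono ex with ex x | uniform-bound L mono ex
  ... | m , Pm | n , Pn = m ℕ.⊔ n , λ
    { (here refl) → mono (ℕ.m≤m⊔n m n) Pm ; (there y∈L) → mono (ℕ.m≤n⊔m m n) (Pn y∈L) }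

-- Reversible Markov operators

module DoubleSum {X : Set} (L : List X) where
  open OrderedField
  open Summation

  ∑∑ : (X → X → ℚ) → ℚ
  ∑∑ f = ∑ L (λ i → ∑ L (f i))

  ∑∑-cong : ∀ {f g : X → X → ℚ} → (∀ i j → f i j ≡ g i j) → ∑∑ f ≡ ∑∑ g
  ∑∑-cong eq = ∑-cong L (λ i → ∑-cong L (eq i))

  ∑∑-mono : ∀ {f g : X → X → ℚ} → (∀ i j → f i j ≤ g i j) → ∑∑ f ≤ ∑∑ g
  ∑∑-mono le = ∑-mono L (λ i → ∑-mono L (le i))

  ∑∑-+ : ∀ (f g : X → X → ℚ) → ∑∑ (λ i j → f i j + g i j) ≡ ∑∑ f + ∑∑ g
  ∑∑-+ f g = trans (∑-cong L (λ i → ∑-+ L (f i) (g i))) (∑-+ L _ _)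

  ∑∑-*ˡ : ∀ c (f : X → X → ℚ) → ∑∑ (λ i j → c * f i j) ≡ c * ∑∑ f
  ∑∑-*ˡ c f = trans (∑-cong L (λ i → ∑-*ˡ L c (f i))) (∑-*ˡ L c _)

  ∑∑-product : ∀ (f g : X → ℚ) → ∑∑ (λ i j → f i * g j) ≡ ∑ L f * ∑ L g
  ∑∑-product f g = trans (∑-cong L (λ i → ∑-*ˡ L (f i) g)) (∑-*ʳ L (∑ L g) f)

  ∑∑-swap : ∀ (f : X → X → ℚ) → ∑∑ f ≡ ∑∑ (λ i j → f j i)
  ∑∑-swap f = ∑-swap L L f

  -- From 2 v_i v_j ≤ v_i² + v_j².
  symmetric-form≤row-sums : ∀ (M : X → X → ℚ) → (∀ i j → M i j ≡ M j i) → (∀ i j → 0ℚ ≤ M i j) →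
    ∀ (v : X → ℚ) → ∑∑ (λ i j → M i j * (v i * v j)) ≤ ∑ L (λ i → ∑ L (M i) * (v i * v i))
  symmetric-form≤row-sums M M-sym M≥0 v =
    *-cancelˡ-≤ (1ℚ + 1ℚ) (+-pos 0<1 (<⇒≤ 0<1)) (subst₂ _≤_ lhs rhs (∑∑-mono pointwise))
    where
    pointwise : ∀ i j → M i j * (v i * v j) + M i j * (v i * v j) ≤ M i j * (v i * v i) + M i j * (v j * v j)
    pointwise i j = p≤p+q (*-nonneg (M≥0 i j) (sq-nonneg (v i - v j)))
      (solve 3 (λ m a b → m :* (a :* a) :+ m :* (b :* b) :=
        m :* (a :* b) :+ m :* (a :* b) :+ m :* ((a :- b) :* (a :- b))) refl (M i j) (v i) (v j))

    double : ∀ a → a + a ≡ (1ℚ + 1ℚ) * a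
    double = solve 1 (λ a → a :+ a := (con 1ℚ :+ con 1ℚ) :* a) refl

    lhs : ∑∑ (λ i j → M i j * (v i * v j) + M i j * (v i * v j)) ≡ (1ℚ + 1ℚ) * ∑∑ (λ i j → M i j * (v i * v j))
    lhs = trans (∑∑-+ _ _) (double (∑∑ (λ i j → M i j * (v i * v j))))

    row : ∑∑ (λ i j → M i j * (v i * v i)) ≡ ∑ L (λ i → ∑ L (M i) * (v i * v i))
    row = ∑-cong L (λ i → ∑-*ʳ L (v i * v i) (M i))

    rhs : ∑∑ (λ i j → M i j * (v i * v i) + M i j * (v j * v j)) ≡ (1ℚ + 1ℚ) * ∑ L (λ i → ∑ L (M i) * (v i * v i))
    rhs = trans (∑∑-+ _ _) (trans (cong₂ _+_ row
      (trans (∑∑-swap _) (trans (∑∑-cong (λ i j → cong (_* (v i * v i)) (M-sym j i))) row))) (double (∑ L (λ i → ∑ L (M i) * (v i * v i)))))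

module ReversibleChain {X : Set} (L : List X) (complete : ∀ x → x ∈ L)
  (G : X → X → ℚ) (G-sym : ∀ i j → G i j ≡ G j i) (G≥0 : ∀ i j → 0ℚ ≤ G i j) where
  open OrderedField
  open Summation
  open DoubleSum L

  π : X → ℚ
  π i = ∑ L (G i)

  mass : ℚ
  mass = ∑ L π

  apply : (X → ℚ) → X → ℚ
  apply v i = ∑ L (λ j → G i j * v j)

  -- The transition operator diag(π)⁻¹ G; rows with π i = 0 vanish, and recip 0 = 0.
  A : (X → ℚ) → X → ℚ
  A v i = recip (π i) * apply v i

  ip : (X → ℚ) → (X → ℚ) → ℚ
  ip u v = ∑ L (λ i → π i * (u i * v i))

  mean : (X → ℚ) → ℚ
  mean v = ∑ L (λ i → π i * v i)

  _⊕_ : (X → ℚ) → (X → ℚ) → X → ℚ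
  (u ⊕ v) i = u i + v i

  π≥0 : ∀ i → 0ℚ ≤ π i
  π≥0 i = ∑-nonneg L (G≥0 i)

  row-zero : ∀ {i} → π i ≡ 0ℚ → ∀ j → G i j ≡ 0ℚ
  row-zero {i} πi≡0 j = ≤-antisym (subst (G i j ≤_) πi≡0 (≤-∑ (G≥0 i) (complete j))) (G≥0 i j)

  -- Cancellation survives at π i = 0, since then the whole row of `G` is zero. Later identities
  -- therefore treat loops and nonloops alike.
  π-recip : ∀ i j → π i * (recip (π i) * G i j) ≡ G i j
  π-recip i j with nonneg-cases (π≥0 i)
  ... | inj₂ 0<πi = trans (sym (*-assoc _ _ _)) (trans (cong (_* G i j) (recip-inverse 0<πi)) (*-identityˡ _))
  ... | inj₁ πi≡0 = trans (cong (_* (recip (π i) * G i j)) πi≡0) (trans (zeroˡ _) (sym (row-zero πi≡0 j)))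

  π-A : ∀ v i → π i * A v i ≡ apply v i
  π-A v i = begin
    π i * (recip (π i) * apply v i)                        ≡⟨ cong (π i *_) (sym (∑-*ˡ L _ _)) ⟩
    π i * ∑ L (λ j → recip (π i) * (G i j * v j))          ≡⟨ sym (∑-*ˡ L _ _) ⟩
    ∑ L (λ j → π i * (recip (π i) * (G i j * v j)))        ≡⟨ ∑-cong L (λ j → trans (regroup (π i) (recip (π i)) (G i j) (v j)) (cong (_* v j) (π-recip i j))) ⟩
    apply v i                                              ∎
    where
    open ≡-Reasoning
    regroup : ∀ a b c d → a * (b * (c * d)) ≡ a * (b * c) * d
    regroup = solve 4 (λ a b c d → a :* (b :* (c :* d)) := a :* (b :* c) :* d) refl

  ip-sym : ∀ u v → ip u v ≡ ip v u
  ip-sym u v = ∑-cong L (λ i → cong (π i *_) (*-comm (u i) (v i)))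

  ip-cong : ∀ {u u′ v v′} → (∀ i → u i ≡ u′ i) → (∀ i → v i ≡ v′ i) → ip u v ≡ ip u′ v′
  ip-cong p q = ∑-cong L (λ i → cong₂ (λ a b → π i * (a * b)) (p i) (q i))

  ip-⊕ˡ : ∀ u v w → ip (u ⊕ v) w ≡ ip u w + ip v w
  ip-⊕ˡ u v w = trans (∑-cong L (λ i → solve 4 (λ p a b c → p :* ((a :+ b) :* c) := p :* (a :* c) :+ p :* (b :* c)) refl
    (π i) (u i) (v i) (w i))) (∑-+ L _ _)

  ip-⊕ : ∀ u v w z → ip (u ⊕ v) (w ⊕ z) ≡ (ip u w + ip u z) + (ip v w + ip v z)
  ip-⊕ u v w z = trans (ip-⊕ˡ u v (w ⊕ z)) (cong₂ _+_ (right u) (right v))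
    where
    right : ∀ u → ip u (w ⊕ z) ≡ ip u w + ip u z
    right u = trans (ip-sym u (w ⊕ z)) (trans (ip-⊕ˡ w z u) (cong₂ _+_ (ip-sym w u) (ip-sym z u)))

  ip-nonneg : ∀ v → 0ℚ ≤ ip v v
  ip-nonneg v = ∑-nonneg L (λ i → *-nonneg (π≥0 i) (sq-nonneg (v i)))

  ip-A : ∀ u v → ip (A u) v ≡ ∑ L (λ i → apply u i * v i)
  ip-A u v = ∑-cong L (λ i → trans (sym (*-assoc _ _ _)) (cong (_* v i) (π-A u i)))

  ip-A-form : ∀ u v → ip (A u) v ≡ ∑∑ (λ i j → G i j * (u j * v i))
  ip-A-form u v = trans (ip-A u v) (∑-cong L (λ i → trans (sym (∑-*ʳ L (v i) _)) (∑-cong L (λ j → *-assoc _ _ _))))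

  A-self-adjoint : ∀ u v → ip (A u) v ≡ ip u (A v)
  A-self-adjoint u v = begin
    ip (A u) v                              ≡⟨ ip-A-form u v ⟩
    ∑∑ (λ i j → G i j * (u j * v i))        ≡⟨ ∑∑-swap _ ⟩
    ∑∑ (λ i j → G j i * (u i * v j))        ≡⟨ ∑∑-cong (λ i j → cong₂ _*_ (G-sym j i) (*-comm (u i) (v j))) ⟩
    ∑∑ (λ i j → G i j * (v j * u i))        ≡⟨ sym (ip-A-form v u) ⟩
    ip (A v) u                              ≡⟨ ip-sym (A v) u ⟩
    ip u (A v)                              ∎
    where open ≡-Reasoning

  A-⊕ : ∀ u v i → A (u ⊕ v) i ≡ (A u ⊕ A v) i
  A-⊕ u v i = trans (cong (recip (π i) *_) (trans (∑-cong L (λ j → distribˡ _ _ _)) (∑-+ L _ _))) (distribˡ _ _ _)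

  -- Stationarity of `π`, from the symmetry of `G`. Mean-zero vectors are thus stable under `A`, and
  -- bounds assumed for them can be applied to `A v`.
  mean-A : ∀ v → mean (A v) ≡ mean v
  mean-A v = begin
    mean (A v)                        ≡⟨ ∑-cong L (π-A v) ⟩
    ∑∑ (λ i j → G i j * v j)          ≡⟨ ∑∑-swap _ ⟩
    ∑∑ (λ i j → G j i * v i)          ≡⟨ ∑-cong L (λ i → trans (∑-*ʳ L (v i) _) (cong (_* v i) (∑-cong L (λ j → G-sym j i)))) ⟩
    mean v                            ∎
    where open ≡-Reasoning

  -- The matrix G diag(π)⁻¹ G, which represents the quadratic form ⟨Av,Av⟩: two steps of the chain,
  -- weighted by `π`.
  K : X → X → ℚ
  K i j = ∑ L (λ k → recip (π k) * (G k i * G k j))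

  K-sym : ∀ i j → K i j ≡ K j i
  K-sym i j = ∑-cong L (λ k → cong (recip (π k) *_) (*-comm _ _))

  K-row : ∀ i → ∑ L (K i) ≡ π i
  K-row i = begin
    ∑∑ (λ j k → recip (π k) * (G k i * G k j))        ≡⟨ ∑∑-swap _ ⟩
    ∑∑ (λ k j → recip (π k) * (G k i * G k j))        ≡⟨ ∑-cong L (λ k → trans (∑-*ˡ L _ _) (cong (recip (π k) *_) (∑-*ˡ L _ _))) ⟩
    ∑ L (λ k → recip (π k) * (G k i * π k))           ≡⟨ ∑-cong L (λ k → trans (rotate (recip (π k)) (G k i) (π k)) (π-recip k i)) ⟩
    ∑ L (λ k → G k i)                                 ≡⟨ ∑-cong L (λ k → G-sym k i) ⟩
    π i                                               ∎
    where
    open ≡-Reasoning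
    rotate : ∀ a b c → a * (b * c) ≡ c * (a * b)
    rotate = solve 3 (λ a b c → a :* (b :* c) := c :* (a :* b)) refl

  ip-AA : ∀ v → ip (A v) (A v) ≡ ∑∑ (λ i j → K i j * (v i * v j))
  ip-AA v = begin
    ip (A v) (A v)
      ≡⟨ ip-A v (A v) ⟩
    ∑ L (λ k → apply v k * (recip (π k) * apply v k))
      ≡⟨ ∑-cong L (λ k → trans (rotate (apply v k) (recip (π k))) (trans (cong (recip (π k) *_) (sym (∑∑-product _ _))) (sym (∑∑-*ˡ _ _)))) ⟩
    ∑ L (λ k → ∑∑ (λ i j → recip (π k) * ((G k i * v i) * (G k j * v j))))
      ≡⟨ ∑-swap L L _ ⟩
    ∑ L (λ i → ∑ L (λ k → ∑ L (λ j → recip (π k) * ((G k i * v i) * (G k j * v j)))))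
      ≡⟨ ∑-cong L (λ i → ∑-swap L L _) ⟩
    ∑∑ (λ i j → ∑ L (λ k → recip (π k) * ((G k i * v i) * (G k j * v j))))
      ≡⟨ ∑∑-cong (λ i j → trans (∑-cong L (λ k → regroup (recip (π k)) (G k i) (v i) (G k j) (v j))) (∑-*ʳ L (v i * v j) _)) ⟩
    ∑∑ (λ i j → K i j * (v i * v j)) ∎
    where
    open ≡-Reasoning
    rotate : ∀ a r → a * (r * a) ≡ r * (a * a)
    rotate = solve 2 (λ a r → a :* (r :* a) := r :* (a :* a)) refl
    regroup : ∀ r g a h b → r * ((g * a) * (h * b)) ≡ r * (g * h) * (a * b)
    regroup = solve 5 (λ r g a h b → r :* ((g :* a) :* (h :* b)) := r :* (g :* h) :* (a :* b)) refl

  module Gap (0<mass : 0ℚ < mass)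
    (connected : ∀ i j → 0ℚ < π i → 0ℚ < π j → ∃[ k ] (0ℚ < G k i × 0ℚ < G k j)) where

    -- Doeblin's condition: two-step transition probabilities dominate a multiple of the stationary measure.
    Minorised : ℕ → X → X → Set
    Minorised m i j = π i * π j ≤ fromℕ m * mass * K i j

    K-term≥0 : ∀ i j k → 0ℚ ≤ recip (π k) * (G k i * G k j)
    K-term≥0 i j k = *-nonneg (recip-nonneg (π k)) (*-nonneg (G≥0 k i) (G≥0 k j))

    K≥0 : ∀ i j → 0ℚ ≤ K i j
    K≥0 i j = ∑-nonneg L (K-term≥0 i j)

    K>0 : ∀ i j → 0ℚ < π i → 0ℚ < π j → 0ℚ < K i j
    K>0 i j 0<πi 0<πj with connected i j 0<πi 0<πj
    ... | k , 0<Gki , 0<Gkj = ∑-pos (K-term≥0 i j) (complete k)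
      (*-pos (recip-pos (∑-pos (G≥0 k) (complete i) 0<Gki)) (*-pos 0<Gki 0<Gkj))

    minorised-mono : ∀ {m n} i j → m ℕ.≤ n → Minorised m i j → Minorised n i j
    minorised-mono {m} {n} i j m≤n le = ≤-trans le
      (subst₂ _≤_ (rotate mass (K i j) (fromℕ m)) (rotate mass (K i j) (fromℕ n))
        (*-monoˡ-≤ (mass * K i j) (*-nonneg (<⇒≤ 0<mass) (K≥0 i j)) (fromℕ-mono-≤ m≤n)))
      where
      rotate : ∀ s k m → (s * k) * m ≡ m * s * k
      rotate = solve 3 (λ s k m → (s :* k) :* m := m :* s :* k) refl

    minorised-at : ∀ i j → ∃[ m ] Minorised m i j
    minorised-at i j with nonneg-cases (π≥0 i) | nonneg-cases (π≥0 j)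
    ... | inj₁ πi≡0 | _ = 0 , ≤-reflexive (trans (cong (_* π j) πi≡0) (solve 3 (λ a b c → con 0ℚ :* a := con 0ℚ :* b :* c) refl _ _ _))
    ... | inj₂ _ | inj₁ πj≡0 = 0 , ≤-reflexive (trans (cong (π i *_) πj≡0) (solve 3 (λ a b c → a :* con 0ℚ := con 0ℚ :* b :* c) refl (π i) mass (K i j)))
    ... | inj₂ 0<πi | inj₂ 0<πj = m , subst₂ _≤_ back (rotate mass (K i j) (fromℕ m)) (*-monoˡ-≤ c (<⇒≤ 0<c) bound)
      where
      c = mass * K i j
      0<c : 0ℚ < c
      0<c = *-pos 0<mass (K>0 i j 0<πi 0<πj)
      m = proj₁ (archimedean (recip c * (π i * π j)))
      bound : recip c * (π i * π j) ≤ fromℕ m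
      bound = proj₂ (archimedean (recip c * (π i * π j)))
      back : c * (recip c * (π i * π j)) ≡ π i * π j
      back = trans (sym (*-assoc _ _ _)) (trans (cong (_* (π i * π j)) (recip-inverse 0<c)) (*-identityˡ _))
      rotate : ∀ s k m → (s * k) * m ≡ m * s * k
      rotate = solve 3 (λ s k m → (s :* k) :* m := m :* s :* k) refl

    minorised-row : ∀ i → ∃[ m ] (∀ j → Minorised m i j)
    minorised-row i = proj₁ bound , λ j → proj₂ bound (complete j)
      where
      bound : ∃[ m ] (∀ {j} → j ∈ L → Minorised m i j)
      bound = uniform-bound L (λ {j} m≤n → minorised-mono i j m≤n) (minorised-at i)

    minorised : ∃[ m ] (∀ i j → Minorised m i j)
    minorised = proj₁ bound , λ i → proj₂ bound (complete i)
      where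
      bound : ∃[ m ] (∀ {i} → i ∈ L → ∀ j → Minorised m i j)
      bound = uniform-bound L (λ {i} m≤n le j → minorised-mono i j m≤n (le j)) minorised-row

    -- Doeblin's condition makes the matrix m mass K - π πᵀ nonnegative, so its form is bounded by
    -- its row sums. On mean-zero vectors the rank-one part adds nothing to the form, yet it lowers
    -- the i-th row sum by π i times the mass; that loss is the gap.
    spectral-gap : ∃[ m ] (∀ v → mean v ≡ 0ℚ → fromℕ (suc m) * ip (A v) (A v) + ip v v ≤ fromℕ (suc m) * ip v v)
    spectral-gap = proj₁ minorised , gap
      where
      -- The successor makes the constant visibly positive, so that it can be cancelled later.
      m = fromℕ (suc (proj₁ minorised))
      M : X → X → ℚ
      M i j = m * mass * K i j - π i * π j

      M-sym : ∀ i j → M i j ≡ M j i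
      M-sym i j = cong₂ _-_ (cong (m * mass *_) (K-sym i j)) (*-comm _ _)

      row : ∀ i → ∑ L (M i) + π i * mass ≡ m * mass * π i
      row i = begin
        ∑ L (M i) + π i * mass                     ≡⟨ cong (∑ L (M i) +_) (sym (∑-*ˡ L (π i) π)) ⟩
        ∑ L (M i) + ∑ L (λ j → π i * π j)          ≡⟨ sym (∑-+ L _ _) ⟩
        ∑ L (λ j → M i j + π i * π j)              ≡⟨ ∑-cong L (λ j → solve 2 (λ a b → a :- b :+ b := a) refl (m * mass * K i j) (π i * π j)) ⟩
        ∑ L (λ j → m * mass * K i j)               ≡⟨ ∑-*ˡ L _ _ ⟩
        m * mass * ∑ L (K i)                       ≡⟨ cong (m * mass *_) (K-row i) ⟩
        m * mass * π i                             ∎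
        where open ≡-Reasoning

      form : ∀ v → ∑∑ (λ i j → M i j * (v i * v j)) + mean v * mean v ≡ m * mass * ip (A v) (A v)
      form v = begin
        ∑∑ (λ i j → M i j * (v i * v j)) + mean v * mean v
          ≡⟨ cong (∑∑ (λ i j → M i j * (v i * v j)) +_) (sym (∑∑-product _ _)) ⟩
        ∑∑ (λ i j → M i j * (v i * v j)) + ∑∑ (λ i j → (π i * v i) * (π j * v j))
          ≡⟨ sym (∑∑-+ _ _) ⟩
        ∑∑ (λ i j → M i j * (v i * v j) + (π i * v i) * (π j * v j))
          ≡⟨ ∑∑-cong (λ i j → solve 5 (λ k a b x y → (k :- a :* b) :* (x :* y) :+ (a :* x) :* (b :* y) := k :* (x :* y)) refl (m * mass * K i j) (π i) (π j) (v i) (v j)) ⟩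
        ∑∑ (λ i j → m * mass * K i j * (v i * v j))
          ≡⟨ ∑∑-cong (λ i j → *-assoc _ _ _) ⟩
        ∑∑ (λ i j → m * mass * (K i j * (v i * v j)))
          ≡⟨ trans (∑∑-*ˡ _ _) (cong (m * mass *_) (sym (ip-AA v))) ⟩
        m * mass * ip (A v) (A v) ∎
        where open ≡-Reasoning

      rows : ∀ v → ∑ L (λ i → ∑ L (M i) * (v i * v i)) + mass * ip v v ≡ m * mass * ip v v
      rows v = begin
        ∑ L (λ i → ∑ L (M i) * (v i * v i)) + mass * ip v v
          ≡⟨ cong (∑ L (λ i → ∑ L (M i) * (v i * v i)) +_) (sym (∑-*ˡ L mass _)) ⟩
        ∑ L (λ i → ∑ L (M i) * (v i * v i)) + ∑ L (λ i → mass * (π i * (v i * v i)))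
          ≡⟨ sym (∑-+ L _ _) ⟩
        ∑ L (λ i → ∑ L (M i) * (v i * v i) + mass * (π i * (v i * v i)))
          ≡⟨ ∑-cong L (λ i → trans (solve 4 (λ r s p x → r :* x :+ s :* (p :* x) := (r :+ p :* s) :* x) refl (∑ L (M i)) mass (π i) (v i * v i))
               (trans (cong (_* (v i * v i)) (row i)) (*-assoc _ _ _))) ⟩
        ∑ L (λ i → m * mass * (π i * (v i * v i)))
          ≡⟨ ∑-*ˡ L _ _ ⟩
        m * mass * ip v v ∎
        where open ≡-Reasoning

      gap : ∀ v → mean v ≡ 0ℚ → m * ip (A v) (A v) + ip v v ≤ m * ip v v
      gap v mean≡0 = *-cancelˡ-≤ mass 0<mass (subst₂ _≤_ lhs (trans (rows v) (solve 3 (λ m s a → m :* s :* a := s :* (m :* a)) refl m mass (ip v v)))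
        (+-mono-≤ (symmetric-form≤row-sums M M-sym (λ i j → difference-nonneg (minorised-mono i j (ℕ.n≤1+n (proj₁ minorised)) (proj₂ minorised i j))) v) (≤-refl {mass * ip v v})))
        where
        lhs : ∑∑ (λ i j → M i j * (v i * v j)) + mass * ip v v ≡ mass * (m * ip (A v) (A v) + ip v v)
        lhs = begin
          ∑∑ (λ i j → M i j * (v i * v j)) + mass * ip v v
            ≡⟨ cong (_+ mass * ip v v) (trans (sym (+-identityʳ _)) (cong (∑∑ (λ i j → M i j * (v i * v j)) +_) (sym (trans (cong (_* mean v) mean≡0) (zeroˡ _))))) ⟩
          ∑∑ (λ i j → M i j * (v i * v j)) + mean v * mean v + mass * ip v v
            ≡⟨ cong (_+ mass * ip v v) (form v) ⟩
          m * mass * ip (A v) (A v) + mass * ip v v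
            ≡⟨ solve 4 (λ m s a b → m :* s :* a :+ s :* b := s :* (m :* a :+ b)) refl m mass (ip (A v) (A v)) (ip v v) ⟩
          mass * (m * ip (A v) (A v) + ip v v) ∎
          where open ≡-Reasoning

    module _ (bochner : ∀ v → ip (A v) v ≤ ip (A v) (A v)) where

      -- The Bochner inequality at v + Av: with aᵢ = ⟨Aⁱv,v⟩ it reads a₁ + 2a₂ + a₃ ≤ a₂ + 2a₃ + a₄.
      moments : ∀ v → ip (A v) v + ip (A v) (A v) ≤ ip (A (A v)) (A v) + ip (A (A v)) (A (A v))
      moments v = +-cancelʳ-≤ (a₂ + a₃) (subst₂ _≤_ lhs rhs (bochner (v ⊕ A v)))
        where
        a₁ = ip (A v) v
        a₂ = ip (A v) (A v)
        a₃ = ip (A (A v)) (A v)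
        a₄ = ip (A (A v)) (A (A v))
        lhs : ip (A (v ⊕ A v)) (v ⊕ A v) ≡ a₁ + a₂ + (a₂ + a₃)
        lhs = trans (ip-cong (A-⊕ v (A v)) (λ _ → refl)) (trans (ip-⊕ (A v) (A (A v)) v (A v))
          (cong (λ a → a₁ + a₂ + (a + a₃)) (A-self-adjoint (A v) v)))
        rhs : ip (A (v ⊕ A v)) (A (v ⊕ A v)) ≡ a₃ + a₄ + (a₂ + a₃)
        rhs = trans (ip-cong (A-⊕ v (A v)) (A-⊕ v (A v))) (trans (ip-⊕ (A v) (A (A v)) (A v) (A (A v)))
          (trans (cong (λ a → a₂ + a + (a₃ + a₄)) (ip-sym (A v) (A (A v))))
            (solve 3 (λ a b c → a :+ b :+ (b :+ c) := b :+ c :+ (a :+ b)) refl a₂ a₃ a₄)))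

      module _ (m : ℕ) (gap : ∀ v → mean v ≡ 0ℚ → fromℕ (suc m) * ip (A v) (A v) + ip v v ≤ fromℕ (suc m) * ip v v) where
        μ = fromℕ (suc m)

        contraction : ∀ v → mean v ≡ 0ℚ → ip (A v) (A v) ≤ ip v v
        contraction v mean≡0 = *-cancelˡ-≤ μ (fromℕ-pos m) (≤-trans (p≤p+q (ip-nonneg v) refl) (gap v mean≡0))

        -- At `A v` the assumed bound gives μ a₃ ≤ (1 + κ) a₂ and the gap gives μ a₄ ≤ (μ - 1) a₂.
        -- Inserted into μ times `moments`, these leave μ a₁ ≤ κ a₂: the unit gained is exactly the
        -- one lost in the gap. Contraction bounds a₂ by ⟨v,v⟩.
        improve : ∀ κ → 0ℚ ≤ κ → (∀ v → mean v ≡ 0ℚ → μ * ip (A v) v ≤ (1ℚ + κ) * ip v v) →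
          ∀ v → mean v ≡ 0ℚ → μ * ip (A v) v ≤ κ * ip v v
        improve κ 0≤κ bound v mean≡0 = ≤-trans
          (+-cancelʳ-≤ (μ * a₂ + μ * a₃ + (μ * a₄ + a₂)) (subst₂ _≤_
            (solve 6 (λ μ κ a₁ a₂ a₃ a₄ → μ :* (a₁ :+ a₂) :+ (μ :* a₃ :+ (μ :* a₄ :+ a₂)) :=
              μ :* a₁ :+ (μ :* a₂ :+ μ :* a₃ :+ (μ :* a₄ :+ a₂))) refl μ κ a₁ a₂ a₃ a₄)
            (solve 6 (λ μ κ a₁ a₂ a₃ a₄ → μ :* (a₃ :+ a₄) :+ ((con 1ℚ :+ κ) :* a₂ :+ μ :* a₂) :=
              κ :* a₂ :+ (μ :* a₂ :+ μ :* a₃ :+ (μ :* a₄ :+ a₂))) refl μ κ a₁ a₂ a₃ a₄)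
            (+-mono-≤ (*-monoˡ-≤ μ (fromℕ-nonneg (suc m)) (moments v)) (+-mono-≤ (bound (A v) mean-A≡0) (gap (A v) mean-A≡0)))))
          (*-monoˡ-≤ κ 0≤κ (contraction v mean≡0))
          where
          mean-A≡0 = trans (mean-A v) mean≡0
          a₁ = ip (A v) v
          a₂ = ip (A v) (A v)
          a₃ = ip (A (A v)) (A v)
          a₄ = ip (A (A v)) (A (A v))

        descent : ∀ k → (∀ v → mean v ≡ 0ℚ → μ * ip (A v) v ≤ fromℕ k * ip v v) →
          ∀ v → mean v ≡ 0ℚ → μ * ip (A v) v ≤ 0ℚ * ip v v
        descent zero bound = bound
        descent (suc k) bound = descent k (improve (fromℕ k) (fromℕ-nonneg k) bound)

      negative-on-mean-zero : ∀ v → mean v ≡ 0ℚ → ip (A v) v ≤ 0ℚ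
      negative-on-mean-zero v mean≡0 = *-cancelˡ-≤ (fromℕ (suc m)) (fromℕ-pos m)
        (subst (fromℕ (suc m) * ip (A v) v ≤_) (trans (zeroˡ _) (sym (zeroʳ _)))
          -- Bochner and contraction give the initial bound μ ⟨Av,v⟩ ≤ μ ⟨v,v⟩. As μ = m + 1,
          -- lowering the constant by 1 in each of m + 1 rounds reaches 0.
          (descent m gap (suc m) (λ u mean≡0 → *-monoˡ-≤ _ (fromℕ-nonneg (suc m))
            (≤-trans (bochner u) (contraction m gap u mean≡0))) v mean≡0))
        where
        m = proj₁ spectral-gap
        gap = proj₂ spectral-gap

-- Polarized basis generating polynomials

-- Families of bases are given by their characteristic function on lists, so that contraction by x is precomposition with x ∷_.
record MatroidLike {X : Set} (φ : List X → Bool) : Set where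
  field
    symmetric : ∀ {s t} → s ↭ t → φ s ≡ φ t
    irreflexive : ∀ i t → φ (i ∷ i ∷ t) ≡ false
    -- A basis through `i` and `k` admits `j` by giving up one element, so `i` or `k` stays. This
    -- weak form suffices both for transitivity of parallelism and for common neighbours. The prefix
    -- `s` stands for contracted elements and makes the axiom pass to contractions.
    exchange : ∀ s {i k j t u} → φ (s ++ i ∷ k ∷ t) ≡ true → φ (s ++ j ∷ u) ≡ true →
      ∃[ v ] (length v ≡ length t × (φ (s ++ i ∷ j ∷ v) ≡ true ⊎ φ (s ++ k ∷ j ∷ v) ≡ true))

contract : ∀ {X : Set} {φ : List X → Bool} → MatroidLike φ → ∀ x → MatroidLike (φ ∘ (x ∷_))
contract {φ = φ} M x = record
  { symmetric = λ p → symmetric (prep x p)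
  ; irreflexive = λ i t → trans (symmetric (↭-trans (swap x i ↭-refl) (prep i (swap x i ↭-refl)))) (irreflexive i (x ∷ t))
  ; exchange = λ s → exchange (x ∷ s) }
  where open MatroidLike M

module Polarization {X : Set} (L : List X) (complete : ∀ x → x ∈ L) where
  open OrderedField
  open Summation
  open DoubleSum L

  -- The polarization of the basis generating polynomial, up to the factor (length zs)!.
  F : List (X → ℚ) → (List X → Bool) → ℚ
  F [] φ = indicator (φ [])
  F (z ∷ zs) φ = ∑ L (λ x → z x * F zs (φ ∘ (x ∷_)))

  Nonneg Pos : (X → ℚ) → Set
  Nonneg z = ∀ x → 0ℚ ≤ z x
  Pos z = ∀ x → 0ℚ < z x

  F-cong : ∀ zs {φ ψ} → (∀ t → φ t ≡ ψ t) → F zs φ ≡ F zs ψ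
  F-cong [] eq = cong indicator (eq [])
  F-cong (z ∷ zs) eq = ∑-cong L (λ x → cong (z x *_) (F-cong zs (λ t → eq (x ∷ t))))

  F-linear : ∀ a b x y zs φ → F ((λ i → a * x i + b * y i) ∷ zs) φ ≡ a * F (x ∷ zs) φ + b * F (y ∷ zs) φ
  F-linear a b x y zs φ = trans
    (∑-cong L (λ i → solve 5 (λ a b x y f → (a :* x :+ b :* y) :* f := a :* (x :* f) :+ b :* (y :* f)) refl
      a b (x i) (y i) (F zs (φ ∘ (i ∷_)))))
    (trans (∑-+ L _ _) (cong₂ _+_ (∑-*ˡ L a _) (∑-*ˡ L b _)))

  F-form : ∀ x y zs φ → F (x ∷ y ∷ zs) φ ≡ ∑∑ (λ i j → F zs (λ t → φ (i ∷ j ∷ t)) * (x i * y j))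
  F-form x y zs φ = ∑-cong L (λ i → trans (sym (∑-*ˡ L (x i) _))
    (∑-cong L (λ j → solve 3 (λ a b c → a :* (b :* c) := c :* (a :* b)) refl (x i) (y j) _)))

  F-swap : ∀ {φ} → MatroidLike φ → ∀ x y zs → F (x ∷ y ∷ zs) φ ≡ F (y ∷ x ∷ zs) φ
  F-swap {φ} M x y zs = begin
    F (x ∷ y ∷ zs) φ                                               ≡⟨ F-form x y zs φ ⟩
    ∑∑ (λ i j → F zs (λ t → φ (i ∷ j ∷ t)) * (x i * y j))          ≡⟨ ∑∑-swap _ ⟩
    ∑∑ (λ i j → F zs (λ t → φ (j ∷ i ∷ t)) * (x j * y i))
      ≡⟨ ∑∑-cong (λ i j → cong₂ _*_ (F-cong zs (λ t → symmetric (swap j i ↭-refl))) (*-comm (x j) (y i))) ⟩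
    ∑∑ (λ i j → F zs (λ t → φ (i ∷ j ∷ t)) * (y i * x j))          ≡⟨ sym (F-form y x zs φ) ⟩
    F (y ∷ x ∷ zs) φ ∎
    where
    open ≡-Reasoning
    open MatroidLike M

  -- Brings the third vector to the front, where it becomes the weight of an average over
  -- contractions.
  F-rotate : ∀ {φ} → MatroidLike φ → ∀ x y z zs → F (x ∷ y ∷ z ∷ zs) φ ≡ F (z ∷ x ∷ y ∷ zs) φ
  F-rotate M x y z zs =
    trans (∑-cong L (λ i → cong (x i *_) (F-swap (contract M i) y z zs))) (F-swap M x z (y ∷ zs))

  F-nonneg : ∀ {zs} → All Nonneg zs → ∀ φ → 0ℚ ≤ F zs φ
  F-nonneg [] φ = indicator-nonneg (φ [])
  F-nonneg (z≥0 ∷ zs≥0) φ = ∑-nonneg L (λ x → *-nonneg (z≥0 x) (F-nonneg zs≥0 _))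

  pos⇒nonneg : ∀ {zs} → All Pos zs → All Nonneg zs
  pos⇒nonneg [] = []
  pos⇒nonneg (z>0 ∷ zs>0) = (λ x → <⇒≤ (z>0 x)) ∷ pos⇒nonneg zs>0

  F-pos : ∀ {zs} → All Pos zs → ∀ φ t → length t ≡ length zs → φ t ≡ true → 0ℚ < F zs φ
  F-pos [] φ [] _ φt = subst (λ b → 0ℚ < indicator b) (sym φt) 0<1
  F-pos (z>0 ∷ zs>0) φ (x ∷ t) len φt =
    ∑-pos (λ y → *-nonneg (<⇒≤ (z>0 y)) (F-nonneg (pos⇒nonneg zs>0) _)) (complete x)
      (*-pos (z>0 x) (F-pos zs>0 _ t (ℕ.suc-injective len) φt))

  factor-pos : ∀ {a b} → 0ℚ ≤ b → 0ℚ < a * b → 0ℚ < b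
  factor-pos {a} 0≤b 0<ab with nonneg-cases 0≤b
  ... | inj₂ 0<b = 0<b
  ... | inj₁ b≡0 = ⊥-elim (<-irrefl (sym (trans (cong (a *_) b≡0) (zeroʳ a))) 0<ab)

  F-pos⁻¹ : ∀ {zs} → All Nonneg zs → ∀ φ → 0ℚ < F zs φ → ∃[ t ] (length t ≡ length zs × φ t ≡ true)
  F-pos⁻¹ [] φ 0<F with φ [] in eq
  ... | true = [] , refl , eq
  ... | false = ⊥-elim (<-irrefl refl 0<F)
  F-pos⁻¹ (z≥0 ∷ zs≥0) φ 0<F
    with ∑-pos⁻¹ L (λ x → *-nonneg (z≥0 x) (F-nonneg zs≥0 _)) 0<F
  ... | x , _ , 0<term with F-pos⁻¹ zs≥0 (φ ∘ (x ∷_)) (factor-pos (F-nonneg zs≥0 _) 0<term)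
  ...   | t , len , φt = x ∷ t , cong suc len , φt

  H : List (X → ℚ) → (List X → Bool) → X → X → ℚ
  H zs φ i j = F zs (λ t → φ (i ∷ j ∷ t))

  -- No sign is imposed on `x`, because the Bochner step applies this to arbitrary vectors.
  -- Positivity of `y` lets a basis be extracted from a nonzero value of the form at `y`, and
  -- conversely.
  LogConcave : List (X → ℚ) → (List X → Bool) → Set
  LogConcave zs φ = ∀ x y → Pos y → F (x ∷ x ∷ zs) φ * F (y ∷ y ∷ zs) φ ≤ F (x ∷ y ∷ zs) φ * F (x ∷ y ∷ zs) φ

  -- A form that is nonpositive on the kernel of a functional ℓ satisfies the reversed Cauchy–Schwarz inequality:
  -- test it on the combination of x and y killed by ℓ.
  reversed-Cauchy-Schwarz : ∀ {φ} → MatroidLike φ → ∀ zs (ℓ : (X → ℚ) → ℚ) →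
    (∀ a b x y → ℓ (λ i → a * x i + b * y i) ≡ a * ℓ x + b * ℓ y) →
    (∀ v → ℓ v ≡ 0ℚ → F (v ∷ v ∷ zs) φ ≤ 0ℚ) →
    ∀ x y → 0ℚ ≤ F (y ∷ y ∷ zs) φ → 0ℚ < ℓ y →
    F (x ∷ x ∷ zs) φ * F (y ∷ y ∷ zs) φ ≤ F (x ∷ y ∷ zs) φ * F (x ∷ y ∷ zs) φ
  reversed-Cauchy-Schwarz {φ} M zs ℓ ℓ-linear nonpos x y 0≤q 0<b =
    -- The identity b² (r² - p q) = (a q - b r)² - q F(u,u), where F(u,u) ≤ 0 ≤ q.
    *-cancelˡ-≤ (b * b) (*-pos 0<b 0<b) (p≤p+q
      (+-nonneg (sq-nonneg (a * q - b * r)) (*-nonneg 0≤q (difference-nonneg (nonpos u ℓu≡0))))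
      (trans (solve 5 (λ a b p q r → b :* b :* (r :* r) := b :* b :* (p :* q) :+
          ((a :* q :- b :* r) :* (a :* q :- b :* r) :+
            q :* (con 0ℚ :- (b :* (b :* p :+ (:- a) :* r) :+ (:- a) :* (b :* r :+ (:- a) :* q))))) refl a b p q r)
        (cong (λ e → b * b * (p * q) + ((a * q - b * r) * (a * q - b * r) + q * (0ℚ - e))) (sym expand))))
    where
    a = ℓ x
    b = ℓ y
    p = F (x ∷ x ∷ zs) φ
    q = F (y ∷ y ∷ zs) φ
    r = F (x ∷ y ∷ zs) φ
    u : X → ℚ
    u i = b * x i + (- a) * y i

    ℓu≡0 : ℓ u ≡ 0ℚ
    ℓu≡0 = trans (ℓ-linear b (- a) x y) (solve 2 (λ a b → b :* a :+ (:- a) :* b := con 0ℚ) refl a b)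

    right : ∀ z → F (z ∷ u ∷ zs) φ ≡ b * F (z ∷ x ∷ zs) φ + (- a) * F (z ∷ y ∷ zs) φ
    right z = trans (F-swap M z u zs) (trans (F-linear b (- a) x y (z ∷ zs) φ)
      (cong₂ (λ c d → b * c + (- a) * d) (F-swap M x z zs) (F-swap M y z zs)))

    expand : F (u ∷ u ∷ zs) φ ≡ b * (b * p + (- a) * r) + (- a) * (b * r + (- a) * q)
    expand = trans (F-linear b (- a) x y (u ∷ zs) φ) (cong₂ (λ c d → b * c + (- a) * d) (right x)
      (trans (right y) (cong (λ c → b * c + (- a) * q) (F-swap M y x zs))))

  F-degenerate : ∀ {φ} zs x y → F (y ∷ y ∷ zs) φ ≡ 0ℚ →
    F (x ∷ x ∷ zs) φ * F (y ∷ y ∷ zs) φ ≤ F (x ∷ y ∷ zs) φ * F (x ∷ y ∷ zs) φ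
  F-degenerate {φ} zs x y q≡0 = subst (_≤ r * r) (sym (trans (cong (F (x ∷ x ∷ zs) φ *_) q≡0) (zeroʳ _))) (sq-nonneg r)
    where r = F (x ∷ y ∷ zs) φ

  module _ {zs : List (X → ℚ)} (zs>0 : All Pos zs) where
    H-nonneg : ∀ φ i j → 0ℚ ≤ H zs φ i j
    H-nonneg φ i j = F-nonneg (pos⇒nonneg zs>0) _

    H-pos : ∀ φ i j t → length t ≡ length zs → φ (i ∷ j ∷ t) ≡ true → 0ℚ < H zs φ i j
    H-pos φ i j t = F-pos zs>0 _ t

    H-pos⁻¹ : ∀ φ i j → 0ℚ < H zs φ i j → ∃[ t ] (length t ≡ length zs × φ (i ∷ j ∷ t) ≡ true)
    H-pos⁻¹ φ i j = F-pos⁻¹ (pos⇒nonneg zs>0) _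

    form-pos⁻¹ : ∀ φ y → Pos y → 0ℚ < F (y ∷ y ∷ zs) φ → ∃[ t ] (length t ≡ length (y ∷ y ∷ zs) × φ t ≡ true)
    form-pos⁻¹ φ y y>0 = F-pos⁻¹ (pos⇒nonneg (y>0 ∷ y>0 ∷ zs>0)) φ

    -- If the form vanishes at `y`, the left side is 0. Otherwise a basis exists, and it supplies
    -- the strict positivity that the main argument needs.
    log-concave-from-basis : ∀ φ x y → Pos y →
      (∀ t → length t ≡ length (y ∷ y ∷ zs) → φ t ≡ true →
        F (x ∷ x ∷ zs) φ * F (y ∷ y ∷ zs) φ ≤ F (x ∷ y ∷ zs) φ * F (x ∷ y ∷ zs) φ) →
      F (x ∷ x ∷ zs) φ * F (y ∷ y ∷ zs) φ ≤ F (x ∷ y ∷ zs) φ * F (x ∷ y ∷ zs) φ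
    log-concave-from-basis φ x y y>0 given =
      [ F-degenerate {φ} zs x y , (λ 0<q → let (t , len , φt) = form-pos⁻¹ φ y y>0 0<q in given t len φt) ]′
        (nonneg-cases (F-nonneg (pos⇒nonneg (y>0 ∷ y>0 ∷ zs>0)) φ))

    -- For positive vectors a zero value means that there are no bases of this size, so every
    -- coefficient of the form is zero.
    form-zero : ∀ φ w → Pos w → F (w ∷ w ∷ zs) φ ≡ 0ℚ → ∀ v → F (v ∷ v ∷ zs) φ ≡ 0ℚ
    form-zero φ w w>0 q≡0 v = trans (F-form v v zs φ)
      (trans (∑∑-cong (λ i j → trans (cong (_* (v i * v j)) (H≡0 i j)) (zeroˡ _)))
        (trans (∑-cong L (λ _ → ∑-zero L)) (∑-zero L)))
      where
      H≡0 : ∀ i j → H zs φ i j ≡ 0ℚ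
      H≡0 i j = [ id , (λ 0<H → let (t , len , φt) = H-pos⁻¹ φ i j 0<H in
          ⊥-elim (<-irrefl (sym q≡0) (F-pos (w>0 ∷ w>0 ∷ zs>0) φ (i ∷ j ∷ t) (cong (2 ℕ.+_) len) φt))) ]′
        (nonneg-cases (H-nonneg φ i j))

-- Rank two

module LogConcavity {X : Set} (L : List X) (complete : ∀ x → x ∈ L) where
  open OrderedField
  open Summation
  open DoubleSum L
  open Polarization L complete

  -- A loopless rank-2 matroid is a partition into parallel classes: its form is (∑ v)² minus the sum of squared class sums.
  module RankTwo {φ : List X → Bool} (M : MatroidLike φ) where
    open MatroidLike M

    pair : X → X → Bool
    pair i j = φ (i ∷ j ∷ [])

    pair-sym : ∀ i j → pair i j ≡ pair j i
    pair-sym i j = symmetric (swap i j ↭-refl)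

    NonLoop : X → Set
    NonLoop i = ∃[ j ] pair i j ≡ true

    opaque
      nonLoop : X → Bool
      nonLoop i = does (any? (λ j → pair i j Bool.≟ true) L)

      nonLoop⁺ : ∀ {i j} → pair i j ≡ true → nonLoop i ≡ true
      nonLoop⁺ {i} {j} ij = dec-true (any? (λ j → pair i j Bool.≟ true) L) (lose (complete j) ij)

      nonLoop⁻ : ∀ {i} → nonLoop i ≡ true → NonLoop i
      nonLoop⁻ {i} eq with any? (λ j → pair i j Bool.≟ true) L
      ... | yes any = proj₁ (find any) , proj₂ (proj₂ (find any))

    ν : X → ℚ
    ν i = indicator (nonLoop i)

    -- The matrix of parallelism between nonloops; up to ordering it consists of all-ones diagonal
    -- blocks, one for each parallel class.
    p : X → X → ℚ
    p i j = indicator (nonLoop i ∧ nonLoop j ∧ not (pair i j))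

    p-sym : ∀ i j → p i j ≡ p j i
    p-sym i j = cong indicator (trans (sym (Bool.∧-assoc a b _))
      (trans (cong₂ _∧_ (Bool.∧-comm a b) (cong not (pair-sym i j))) (Bool.∧-assoc b a _)))
      where
      a = nonLoop i
      b = nonLoop j

    p≥0 : ∀ i j → 0ℚ ≤ p i j
    p≥0 i j = indicator-nonneg (nonLoop i ∧ nonLoop j ∧ not (pair i j))

    -- A basis contains no loop, and two nonloops either form a basis or are parallel. Summed
    -- against a vector, this turns the form into a square minus the form of `p`.
    pair+p : ∀ i j → indicator (pair i j) + p i j ≡ ν i * ν j
    pair+p i j with nonLoop i in nlᵢ | nonLoop j in nlⱼ | pair i j in ij
    ... | true | true | true = trans (+-identityʳ 1ℚ) (sym (*-identityˡ 1ℚ))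
    ... | true | true | false = trans (+-identityˡ 1ℚ) (sym (*-identityˡ 1ℚ))
    ... | true | false | true = case trans (sym nlⱼ) (nonLoop⁺ (trans (pair-sym j i) ij)) of λ ()
    ... | true | false | false = trans (+-identityˡ 0ℚ) (sym (zeroʳ 1ℚ))
    ... | false | _ | true = case trans (sym nlᵢ) (nonLoop⁺ ij) of λ ()
    ... | false | b | false = trans (+-identityˡ 0ℚ) (sym (zeroˡ (indicator b)))

    -- Exchanging `i` into the basis {k, j} gives the basis {k, i} or {j, i}, and the first is
    -- excluded.
    parallel-transitive : ∀ {i k j} → NonLoop i → pair k i ≡ false → pair k j ≡ true → pair i j ≡ true
    parallel-transitive {i} {k} {j} (_ , nl) k∥i kj with exchange [] {t = []} kj nl
    ... | [] , _ , inj₁ ki = case trans (sym k∥i) ki of λ ()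
    ... | [] , _ , inj₂ ji = trans (pair-sym i j) ji

    parallel-rows : ∀ {i k} → NonLoop i → NonLoop k → pair k i ≡ false → ∀ j → pair k j ≡ pair i j
    parallel-rows {i} {k} nlᵢ nlₖ k∥i j with pair k j in kj | pair i j in ij
    ... | true | true = refl
    ... | false | false = refl
    ... | true | false = trans (sym (parallel-transitive nlᵢ k∥i kj)) ij
    ... | false | true = trans (sym kj) (parallel-transitive nlₖ (trans (pair-sym i k) k∥i) ij)

    p-cases : ∀ k i → p k i ≡ 0ℚ ⊎ (p k i ≡ 1ℚ × ∀ j → p k j ≡ p i j)
    p-cases k i with nonLoop k in nlₖ | nonLoop i in nlᵢ | pair k i in ki
    ... | false | _ | _ = inj₁ refl
    ... | true | false | _ = inj₁ refl
    ... | true | true | true = inj₁ refl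
    ... | true | true | false = inj₂ (refl , λ j →
      cong (λ b → indicator (nonLoop j ∧ not b)) (parallel-rows (nonLoop⁻ nlᵢ) (nonLoop⁻ nlₖ) ki j))

    p-diagonal : ∀ {i} → NonLoop i → p i i ≡ 1ℚ
    p-diagonal {i} (_ , ij) =
      cong indicator (cong₂ _∧_ (nonLoop⁺ ij) (cong₂ (λ a b → a ∧ not b) (nonLoop⁺ ij) (irreflexive i [])))

    open ReversibleChain L complete p p-sym p≥0

    -- 1/π is constant on parallel classes, so that the two-step matrix is p again.
    K≡p : ∀ i j → K i j ≡ p i j
    K≡p i j = trans (∑-cong L term) (trans (∑-*ˡ L _ _) total)
      where
      term : ∀ k → recip (π k) * (p k i * p k j) ≡ p i j * recip (π i) * p i k
      term k with p-cases k i
      ... | inj₁ ki≡0 = trans (cong (λ a → recip (π k) * (a * p k j)) ki≡0)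
        (trans (solve 3 (λ a b c → a :* (con 0ℚ :* b) := c :* con 0ℚ) refl (recip (π k)) (p k j) (p i j * recip (π i)))
          (cong (p i j * recip (π i) *_) (sym (trans (p-sym i k) ki≡0))))
      ... | inj₂ (_ , rows) = trans (cong₂ (λ a b → recip a * (p k i * b)) (∑-cong L rows) (rows j))
        (trans (cong (λ a → recip (π i) * (a * p i j)) (p-sym k i))
          (solve 3 (λ a b c → a :* (b :* c) := c :* a :* b) refl (recip (π i)) (p i k) (p i j)))

      total : p i j * recip (π i) * π i ≡ p i j
      total with nonneg-cases (π≥0 i)
      ... | inj₂ 0<πi = trans (*-assoc _ _ _) (trans (cong (p i j *_) (trans (*-comm _ _) (recip-inverse 0<πi))) (solve 1 (λ a → a :* con 1ℚ := a) refl (p i j)))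
      ... | inj₁ πi≡0 = trans (cong (p i j * recip (π i) *_) πi≡0) (trans (zeroʳ _) (sym (row-zero πi≡0 j)))

    -- By `K≡p` the right side is the sum over k of (`apply v k`)² / π k, with nonnegative terms.
    -- The π a members of the class of `a` contribute equal terms, which add up to its squared class
    -- sum.
    class-sum² : ∀ {a} → NonLoop a → ∀ v → apply v a * apply v a ≤ ∑∑ (λ i j → p i j * (v i * v j))
    class-sum² {a} nl v = subst₂ _≤_ lhs rhs (∑-mono L term)
      where
      term : ∀ k → p a k * (apply v a * A v a) ≤ apply v k * A v k
      term k with p-cases a k
      ... | inj₁ ak≡0 = ≤-trans (≤-reflexive (trans (cong (_* (apply v a * A v a)) ak≡0) (zeroˡ _)))
        (subst (0ℚ ≤_) (solve 2 (λ r w → r :* (w :* w) := w :* (r :* w)) refl (recip (π k)) (apply v k))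
          (*-nonneg (recip-nonneg (π k)) (sq-nonneg (apply v k))))
      ... | inj₂ (ak≡1 , rows) = ≤-reflexive (trans (cong (_* (apply v a * A v a)) ak≡1) (trans (*-identityˡ _)
        (cong₂ (λ n w → w * (recip n * w)) (∑-cong L rows) (∑-cong L (λ j → cong (_* v j) (rows j))))))

      0<πa : 0ℚ < π a
      0<πa = ∑-pos (p≥0 a) (complete a) (subst (0ℚ <_) (sym (p-diagonal nl)) 0<1)

      lhs : ∑ L (λ k → p a k * (apply v a * A v a)) ≡ apply v a * apply v a
      lhs = trans (∑-*ʳ L _ (p a)) (trans (solve 3 (λ n w r → n :* (w :* (r :* w)) := (n :* r) :* (w :* w)) refl (π a) (apply v a) (recip (π a)))
        (trans (cong (_* (apply v a * apply v a)) (recip-inverse 0<πa)) (*-identityˡ _)))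

      rhs : ∑ L (λ k → apply v k * A v k) ≡ ∑∑ (λ i j → p i j * (v i * v j))
      rhs = trans (sym (ip-A v (A v))) (trans (ip-AA v) (∑∑-cong (λ i j → cong (_* (v i * v j)) (K≡p i j))))

    -- The functional sums `v` over the nonloops outside the class of `a`. If it vanishes, the sum
    -- over all nonloops is the class sum of `a`, so its square is already among the squares
    -- subtracted.
    negative-off-class : ∀ {a} → NonLoop a → ∀ v → F (v ∷ []) (φ ∘ (a ∷_)) ≡ 0ℚ → F (v ∷ v ∷ []) φ ≤ 0ℚ
    negative-off-class {a} nl v ℓ≡0 = +-cancelʳ-≤ P (subst₂ _≤_ total (sym (+-identityˡ P)) (class-sum² nl v))
      where
      P = ∑∑ (λ i j → p i j * (v i * v j))

      class : apply v a ≡ ∑ L (λ j → ν j * v j)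
      class = begin
        ∑ L (λ j → p a j * v j)
          ≡⟨ sym (+-identityˡ _) ⟩
        0ℚ + ∑ L (λ j → p a j * v j)
          ≡⟨ cong (_+ apply v a) (sym ℓ≡0) ⟩
        ∑ L (λ j → v j * indicator (pair a j)) + ∑ L (λ j → p a j * v j)
          ≡⟨ sym (∑-+ L _ _) ⟩
        ∑ L (λ j → v j * indicator (pair a j) + p a j * v j)
          ≡⟨ ∑-cong L (λ j → trans (solve 3 (λ v e p → v :* e :+ p :* v := (e :+ p) :* v) refl (v j) (indicator (pair a j)) (p a j))
               (cong (_* v j) (trans (pair+p a j) (trans (cong (_* ν j) νa≡1) (*-identityˡ _))))) ⟩
        ∑ L (λ j → ν j * v j) ∎
        where
        open ≡-Reasoning
        νa≡1 : ν a ≡ 1ℚ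
        νa≡1 = cong indicator (nonLoop⁺ (proj₂ nl))

      total : apply v a * apply v a ≡ F (v ∷ v ∷ []) φ + P
      total = begin
        apply v a * apply v a
          ≡⟨ cong₂ _*_ class class ⟩
        ∑ L (λ j → ν j * v j) * ∑ L (λ j → ν j * v j)
          ≡⟨ sym (∑∑-product _ _) ⟩
        ∑∑ (λ i j → (ν i * v i) * (ν j * v j))
          ≡⟨ ∑∑-cong (λ i j → trans (solve 4 (λ a x b y → (a :* x) :* (b :* y) := (a :* b) :* (x :* y)) refl (ν i) (v i) (ν j) (v j))
               (trans (cong (_* (v i * v j)) (sym (pair+p i j))) (distribʳ _ _ _))) ⟩
        ∑∑ (λ i j → indicator (pair i j) * (v i * v j) + p i j * (v i * v j))
          ≡⟨ ∑∑-+ _ _ ⟩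
        ∑∑ (λ i j → indicator (pair i j) * (v i * v j)) + P
          ≡⟨ cong (_+ P) (sym (F-form v v [] φ)) ⟩
        F (v ∷ v ∷ []) φ + P ∎
        where open ≡-Reasoning

    rank-two : LogConcave [] φ
    rank-two x y y>0 = log-concave-from-basis [] φ x y y>0 λ
      { (a ∷ c ∷ []) _ ac → reversed-Cauchy-Schwarz M [] (λ v → F (v ∷ []) (φ ∘ (a ∷_)))
          (λ s t u v → F-linear s t u v [] (φ ∘ (a ∷_))) (negative-off-class (c , ac)) x y
          (F-nonneg (pos⇒nonneg (y>0 ∷ y>0 ∷ [])) φ) (F-pos (y>0 ∷ []) (φ ∘ (a ∷_)) (c ∷ []) refl ac) }

-- The Alexandrov–Fenchel inequality

module AlexandrovFenchel {X : Set} (L : List X) (complete : ∀ x → x ∈ L) where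
  open OrderedField
  open Summation
  open DoubleSum L
  open Polarization L complete
  open LogConcavity L complete

  module Step {w : X → ℚ} {zs : List (X → ℚ)} (w>0 : Pos w) (zs>0 : All Pos zs)
    {φ : List X → Bool} (M : MatroidLike φ) (contracted : ∀ k → LogConcave zs (φ ∘ (k ∷_))) where
    open MatroidLike M

    h : X → X → ℚ
    h = H (w ∷ zs) φ

    -- Scaling by `w` on both sides is the substitution of w v for v. It turns `w` into the constant
    -- vector, so that dividing by row sums gives a Markov operator.
    G : X → X → ℚ
    G i j = w i * w j * h i j

    w≥0 : Nonneg w
    w≥0 x = <⇒≤ (w>0 x)

    h≥0 : ∀ i j → 0ℚ ≤ h i j
    h≥0 = H-nonneg (w>0 ∷ zs>0) φ

    G≥0 : ∀ i j → 0ℚ ≤ G i j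
    G≥0 i j = *-nonneg (*-nonneg (w≥0 i) (w≥0 j)) (h≥0 i j)

    G-sym : ∀ i j → G i j ≡ G j i
    G-sym i j = cong₂ _*_ (*-comm (w i) (w j)) (F-cong (w ∷ zs) (λ t → symmetric {i ∷ j ∷ t} {j ∷ i ∷ t} (swap i j ↭-refl)))

    open ReversibleChain L complete G G-sym G≥0

    -- The relation between `v` and `u` is a hypothesis so that either may be given: u = w v in the
    -- Bochner inequality, v = u / w in the conclusion.
    apply-value : ∀ {v u} → (∀ i → w i * v i ≡ u i) → ∀ i → apply v i ≡ w i * F (u ∷ w ∷ zs) (φ ∘ (i ∷_))
    apply-value {v} {u} eq i = trans
      (∑-cong L (λ j → trans (solve 4 (λ a b c d → a :* b :* c :* d := a :* (b :* d :* c)) refl (w i) (w j) (h i j) (v j))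
        (cong (λ a → w i * (a * h i j)) (eq j))))
      (∑-*ˡ L (w i) _)

    π-value : ∀ i → π i ≡ w i * F (w ∷ w ∷ zs) (φ ∘ (i ∷_))
    π-value i = trans (∑-cong L (λ j → *-assoc _ _ _)) (∑-*ˡ L (w i) _)

    form-value : ∀ {v u} → (∀ i → w i * v i ≡ u i) → ip (A v) v ≡ F (u ∷ u ∷ w ∷ zs) φ
    form-value {v} {u} eq = trans (ip-A v v) (∑-cong L (λ i → trans (cong (_* v i) (apply-value eq i))
      (trans (solve 3 (λ a b c → a :* b :* c := a :* c :* b) refl (w i) (F (u ∷ w ∷ zs) (φ ∘ (i ∷_))) (v i))
        (cong (_* F (u ∷ w ∷ zs) (φ ∘ (i ∷_))) (eq i)))))

    -- The Bochner inequality: write the form as the w-average of the forms of the contractions and apply their log-concavity.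
    bochner : ∀ v → ip (A v) v ≤ ip (A v) (A v)
    bochner v = subst₂ _≤_ lhs (sym (ip-A v (A v))) (∑-mono L term)
      where
      u : X → ℚ
      u i = w i * v i

      lhs : ∑ L (λ k → w k * F (u ∷ u ∷ zs) (φ ∘ (k ∷_))) ≡ ip (A v) v
      lhs = trans (sym (F-rotate M u u w zs)) (sym (form-value (λ _ → refl)))

      term : ∀ k → w k * F (u ∷ u ∷ zs) (φ ∘ (k ∷_)) ≤ apply v k * (recip (π k) * apply v k)
      term k = [ degenerate , nondegenerate ]′ (nonneg-cases (F-nonneg (pos⇒nonneg (w>0 ∷ w>0 ∷ zs>0)) (φ ∘ (k ∷_))))
        where
        ρ = recip (π k)
        p = F (u ∷ u ∷ zs) (φ ∘ (k ∷_))
        q = F (w ∷ w ∷ zs) (φ ∘ (k ∷_))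
        r = F (u ∷ w ∷ zs) (φ ∘ (k ∷_))

        degenerate : q ≡ 0ℚ → w k * p ≤ apply v k * (ρ * apply v k)
        degenerate q≡0 = ≤-trans
          (≤-reflexive (trans (cong (w k *_) (form-zero zs>0 (φ ∘ (k ∷_)) w w>0 q≡0 u)) (zeroʳ (w k))))
          (subst (0ℚ ≤_) (solve 2 (λ r a → r :* (a :* a) := a :* (r :* a)) refl ρ (apply v k))
            (*-nonneg (recip-nonneg (π k)) (sq-nonneg (apply v k))))

        right : w k * w k * ρ * (r * r) ≡ apply v k * (ρ * apply v k)
        right = trans (solve 3 (λ w s r → w :* w :* s :* (r :* r) := (w :* r) :* (s :* (w :* r))) refl (w k) ρ r)
          (cong (λ a → a * (ρ * a)) (sym (apply-value (λ _ → refl) k)))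

        nondegenerate : 0ℚ < q → w k * p ≤ apply v k * (ρ * apply v k)
        -- The inequality p q ≤ r² of the contraction at `k` is multiplied by w k² / π k. Since π k
        -- = w k q, the left side becomes w k p, while w k r is `apply v k`.
        nondegenerate 0<q = subst₂ _≤_ left right
          (*-monoˡ-≤ (w k * w k * ρ) (*-nonneg (*-nonneg (w≥0 k) (w≥0 k)) (recip-nonneg (π k))) (contracted k u w w>0))
          where
          0<π : 0ℚ < π k
          0<π = subst (0ℚ <_) (sym (π-value k)) (*-pos (w>0 k) 0<q)

          left : w k * w k * ρ * (p * q) ≡ w k * p
          left = trans (solve 4 (λ w r p q → w :* w :* r :* (p :* q) := (w :* q) :* r :* (w :* p)) refl (w k) ρ p q)
            (trans (cong (λ a → a * ρ * (w k * p)) (sym (π-value k)))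
              (trans (cong (_* (w k * p)) (recip-inverse 0<π)) (*-identityˡ _)))

    h-pos : ∀ {i j} t → length t ≡ length (w ∷ zs) → φ (i ∷ j ∷ t) ≡ true → 0ℚ < G i j
    h-pos {i} {j} t len φt = *-pos (*-pos (w>0 i) (w>0 j)) (H-pos (w>0 ∷ zs>0) φ i j t len φt)

    neighbour : ∀ i → 0ℚ < π i → ∃[ a ] ∃[ t ] (length t ≡ length (w ∷ zs) × φ (i ∷ a ∷ t) ≡ true)
    neighbour i 0<πi = a , H-pos⁻¹ (w>0 ∷ zs>0) φ i a (factor-pos (h≥0 i a) (proj₂ (proj₂ witness)))
      where
      witness = ∑-pos⁻¹ L (G≥0 i) 0<πi
      a = proj₁ witness

    -- A basis through `i` has two further elements `a` and `l`; this is where rank at least 3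
    -- enters. Exchanging `j` into it keeps `a` or `l`, and both are neighbours of `i`.
    common-neighbour : ∀ {i j} → ∃[ a ] ∃[ t ] (length t ≡ length (w ∷ zs) × φ (i ∷ a ∷ t) ≡ true) →
      ∃[ b ] ∃[ t ] (length t ≡ length (w ∷ zs) × φ (j ∷ b ∷ t) ≡ true) →
      ∃[ k ] (0ℚ < G k i × 0ℚ < G k j)
    common-neighbour {i} {j} (a , l ∷ t , len , ialt) (b , t′ , _ , jbt)
      with exchange [] {a} {l} {j} {i ∷ t} {b ∷ t′} (trans (symmetric (↭-trans (prep a (swap l i ↭-refl)) (swap a i ↭-refl))) ialt) jbt
    ... | v , len′ , inj₁ ajv = a , h-pos (l ∷ t) len (trans (symmetric (swap a i ↭-refl)) ialt) , h-pos v (trans len′ len) ajv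
    ... | v , len′ , inj₂ ljv = l
      , h-pos (a ∷ t) len (trans (symmetric (↭-trans (swap l i ↭-refl) (prep i (swap l a ↭-refl)))) ialt)
      , h-pos v (trans len′ len) ljv

    connected : ∀ i j → 0ℚ < π i → 0ℚ < π j → ∃[ k ] (0ℚ < G k i × 0ℚ < G k j)
    connected i j 0<πi 0<πj = common-neighbour (neighbour i 0<πi) (neighbour j 0<πj)

    mass-value : mass ≡ F (w ∷ w ∷ w ∷ zs) φ
    mass-value = ∑-cong L π-value

    -- The functional v ↦ F(v, w, w, zs) is the mean of v / w, so on its kernel the spectral
    -- argument makes the form nonpositive. A basis makes it positive at `y` and the mass of the
    -- chain positive.
    log-concave : LogConcave (w ∷ zs) φ
    log-concave x y y>0 = log-concave-from-basis (w>0 ∷ zs>0) φ x y y>0 λ t len φt →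
      reversed-Cauchy-Schwarz M (w ∷ zs) (λ v → F (v ∷ w ∷ w ∷ zs) φ) (λ a b u v → F-linear a b u v (w ∷ w ∷ zs) φ)
        (negative t len φt) x y (F-nonneg (pos⇒nonneg (y>0 ∷ y>0 ∷ w>0 ∷ zs>0)) φ) (F-pos (y>0 ∷ w>0 ∷ w>0 ∷ zs>0) φ t len φt)
      where
      negative : ∀ t → length t ≡ length (w ∷ w ∷ w ∷ zs) → φ t ≡ true →
        ∀ v → F (v ∷ w ∷ w ∷ zs) φ ≡ 0ℚ → F (v ∷ v ∷ w ∷ zs) φ ≤ 0ℚ
      negative t len φt v ℓ≡0 = subst (_≤ 0ℚ) (form-value scale)
        (Gap.negative-on-mean-zero 0<mass connected bochner v/w (trans mean-value ℓ≡0))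
        where
        0<mass : 0ℚ < mass
        0<mass = subst (0ℚ <_) (sym mass-value) (F-pos (w>0 ∷ w>0 ∷ w>0 ∷ zs>0) φ t len φt)

        v/w : X → ℚ
        v/w i = recip (w i) * v i

        scale : ∀ i → w i * v/w i ≡ v i
        scale i = trans (sym (*-assoc _ _ _)) (trans (cong (_* v i) (recip-inverse (w>0 i))) (*-identityˡ _))

        mean-value : mean v/w ≡ F (v ∷ w ∷ w ∷ zs) φ
        mean-value = ∑-cong L (λ i → trans (cong (_* v/w i) (π-value i))
          (trans (solve 3 (λ a b c → a :* b :* c := a :* c :* b) refl (w i) (F (w ∷ w ∷ zs) (φ ∘ (i ∷_))) (v/w i))
            (cong (_* F (w ∷ w ∷ zs) (φ ∘ (i ∷_))) (scale i))))

  log-concave : ∀ {zs} → All Pos zs → ∀ {φ} → MatroidLike φ → LogConcave zs φ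
  log-concave [] M = RankTwo.rank-two M
  log-concave (w>0 ∷ zs>0) M = Step.log-concave w>0 zs>0 M (λ k → log-concave zs>0 (contract M k))

  shift : ℚ → (X → ℚ) → X → ℚ
  shift ε z x = z x + ε

  F-mono : ∀ {ε} → 0ℚ ≤ ε → ∀ {zs} → All Nonneg zs → ∀ φ → F zs φ ≤ F (map (shift ε) zs) φ
  F-mono 0≤ε [] φ = ≤-refl
  F-mono {ε} 0≤ε {z ∷ zs} (z≥0 ∷ zs≥0) φ = ∑-mono L (λ x → *-mono-≤ (z≥0 x)
    (≤-trans (F-nonneg zs≥0 _) (F-mono 0≤ε zs≥0 _)) (p≤p+q 0≤ε refl) (F-mono 0≤ε zs≥0 _))

  -- Lipschitz constant at ε = 0 of ε ↦ F (map (shift ε) zs) φ on [0, 1].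
  slope : List (X → ℚ) → (List X → Bool) → ℚ
  slope [] φ = 0ℚ
  slope (z ∷ zs) φ = ∑ L (λ x → F zs (φ ∘ (x ∷_)) + (z x + 1ℚ) * slope zs (φ ∘ (x ∷_)))

  slope-nonneg : ∀ {zs} → All Nonneg zs → ∀ φ → 0ℚ ≤ slope zs φ
  slope-nonneg [] φ = ≤-refl {0ℚ}
  slope-nonneg (z≥0 ∷ zs≥0) φ = ∑-nonneg L (λ x → +-nonneg (F-nonneg zs≥0 _)
    (*-nonneg (+-nonneg (z≥0 x) (<⇒≤ 0<1)) (slope-nonneg zs≥0 _)))

  F-shift : ∀ {ε} → 0ℚ ≤ ε → ε ≤ 1ℚ → ∀ {zs} → All Nonneg zs → ∀ φ →
    F (map (shift ε) zs) φ ≤ F zs φ + ε * slope zs φ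
  F-shift {ε} 0≤ε ε≤1 [] φ = ≤-reflexive (solve 2 (λ a e → a := a :+ e :* con 0ℚ) refl (indicator (φ [])) ε)
  F-shift {ε} 0≤ε ε≤1 {z ∷ zs} (z≥0 ∷ zs≥0) φ =
    subst (F (map (shift ε) (z ∷ zs)) φ ≤_) (trans (∑-+ L _ _) (cong (F (z ∷ zs) φ +_) (∑-*ˡ L ε _))) (∑-mono L term)
    where
    term : ∀ x → (z x + ε) * F (map (shift ε) zs) (φ ∘ (x ∷_)) ≤
      z x * F zs (φ ∘ (x ∷_)) + ε * (F zs (φ ∘ (x ∷_)) + (z x + 1ℚ) * slope zs (φ ∘ (x ∷_)))
    term x = ≤-trans (*-monoˡ-≤ (z x + ε) (+-nonneg (z≥0 x) 0≤ε) (F-shift 0≤ε ε≤1 zs≥0 _))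
      -- The only quadratic term in ε is absorbed by ε² ≤ ε, which accounts for the summand 1 in
      -- `slope`.
      (p≤p+q (*-nonneg 0≤ε (*-nonneg (difference-nonneg ε≤1) (slope-nonneg zs≥0 (φ ∘ (x ∷_)))))
        (solve 4 (λ z e f s → z :* f :+ e :* (f :+ (z :+ con 1ℚ) :* s) :=
          (z :+ e) :* (f :+ e :* s) :+ e :* ((con 1ℚ :- e) :* s)) refl
          (z x) ε (F zs (φ ∘ (x ∷_))) (slope zs (φ ∘ (x ∷_)))))

  shift-pos : ∀ {ε} → 0ℚ < ε → ∀ {zs} → All Nonneg zs → All Pos (map (shift ε) zs)
  shift-pos 0<ε [] = []
  shift-pos {ε} 0<ε {z ∷ _} (z≥0 ∷ zs≥0) =
    (λ x → subst (0ℚ <_) (+-comm ε (z x)) (+-pos 0<ε (z≥0 x))) ∷ shift-pos 0<ε zs≥0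

  -- All vectors are raised by ε to become positive. This does not decrease the left side, and it
  -- raises r² by at most ε (2 r s + s²), with s the slope; the limit removes the error.
  polarized-log-concave : ∀ {x y zs} → Nonneg x → Nonneg y → All Nonneg zs → ∀ {φ} → MatroidLike φ →
    F (x ∷ x ∷ zs) φ * F (y ∷ y ∷ zs) φ ≤ F (x ∷ y ∷ zs) φ * F (x ∷ y ∷ zs) φ
  polarized-log-concave {x} {y} {zs} x≥0 y≥0 zs≥0 {φ} M = ≤-limit c≥0 λ ε 0<ε ε≤1 →
    let 0≤ε = <⇒≤ 0<ε
        xx≥0 = x≥0 ∷ x≥0 ∷ zs≥0
        yy≥0 = y≥0 ∷ y≥0 ∷ zs≥0
        shifted-nonneg = F-nonneg (pos⇒nonneg (shift-pos 0<ε xy≥0)) φ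
        upper = F-shift 0≤ε ε≤1 xy≥0 φ
    in ≤-trans (*-mono-≤ (F-nonneg xx≥0 φ) (F-nonneg (pos⇒nonneg (shift-pos 0<ε yy≥0)) φ) (F-mono 0≤ε xx≥0 φ) (F-mono 0≤ε yy≥0 φ))
      (≤-trans (log-concave (shift-pos 0<ε zs≥0) M (shift ε x) (shift ε y) (λ i → subst (0ℚ <_) (+-comm ε (y i)) (+-pos 0<ε (y≥0 i))))
      (≤-trans (*-mono-≤ shifted-nonneg (≤-trans shifted-nonneg upper) upper upper)
        (p≤p+q (*-nonneg 0≤ε (*-nonneg (difference-nonneg ε≤1) (sq-nonneg s)))
          (solve 3 (λ r e s → r :* r :+ e :* (r :* s :+ r :* s :+ s :* s) :=
            (r :+ e :* s) :* (r :+ e :* s) :+ e :* ((con 1ℚ :- e) :* (s :* s))) refl r ε s))))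
    where
    xy≥0 = x≥0 ∷ y≥0 ∷ zs≥0
    r = F (x ∷ y ∷ zs) φ
    s = slope (x ∷ y ∷ zs) φ
    c≥0 : 0ℚ ≤ r * s + r * s + s * s
    c≥0 = +-nonneg (+-nonneg rs≥0 rs≥0) (sq-nonneg s)
      where rs≥0 = *-nonneg (F-nonneg xy≥0 φ) (slope-nonneg xy≥0 φ)

-- Set systems with the exchange property

module SetSystem {X P : Set} (_≟_ : DecidableEquality X)
  (mem : P → X → Bool) (ext : ∀ {S T} → (∀ x → mem S x ≡ mem T x) → S ≡ T)
  (set : P → X → Bool → P)
  (mem-set : ∀ S x b → mem (set S x b) x ≡ b)
  (mem-set′ : ∀ S {x y} b → y ≢ x → mem (set S x b) y ≡ mem S y)
  (h : P → Bool) where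

  clash : ∀ {b} {A : Set} → b ≡ true → b ≡ false → A
  clash refl ()

  separated : ∀ {S x y} → mem S x ≡ true → mem S y ≡ false → x ≢ y
  separated x∈S y∉S refl = clash x∈S y∉S

  -- The deletion and the insertion form of basis exchange. The bimatroid axioms directly give
  -- insertion for one family of bases and deletion for its complementary family.
  Exchange⁻ Exchange⁺ : Set
  Exchange⁻ = ∀ S T x → h S ≡ true → h T ≡ true → mem S x ≡ true → mem T x ≡ false →
    ∃[ y ] (mem T y ≡ true × mem S y ≡ false × h (set (set S x false) y true) ≡ true)
  Exchange⁺ = ∀ S T x → h S ≡ true → h T ≡ true → mem T x ≡ true → mem S x ≡ false →
    ∃[ y ] (mem S y ≡ true × mem T y ≡ false × h (set (set S y false) x true) ≡ true)

  -- Replace the elements of T ∖ S other than x by elements of S until T ∖ S = {x}; then exchanging for any y ∈ S ∖ T brings in x.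
  module _ (ex : Exchange⁻) where
    exchange⁺-within : ∀ l {S T x} → h S ≡ true → h T ≡ true → mem T x ≡ true → mem S x ≡ false →
      (∀ {z} → mem T z ≡ true → mem S z ≡ false → z ≡ x ⊎ z ∈ l) →
      ∃[ y ] (mem S y ≡ true × mem T y ≡ false × h (set (set S y false) x true) ≡ true)
    exchange⁺-within [] {S} {T} {x} hS hT x∈T x∉S within with ex T S _ hT hS x∈T x∉S
    ... | y , y∈S , y∉T , _ with ex S T _ hS hT y∈S y∉T
    ...   | z , z∈T , z∉S , hS′ with within z∈T z∉S
    ...     | inj₁ refl = y , y∈S , y∉T , hS′
    exchange⁺-within (a ∷ l) {S} {T} {x} hS hT x∈T x∉S within with a ≟ x | mem T a in a?T | mem S a in a?S
    ... | yes refl | _ | _ = exchange⁺-within l hS hT x∈T x∉S λ z∈T z∉S →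
      case within z∈T z∉S of λ { (inj₁ z≡x) → inj₁ z≡x ; (inj₂ (here z≡x)) → inj₁ z≡x ; (inj₂ (there z∈l)) → inj₂ z∈l }
    ... | no _ | false | _ = exchange⁺-within l hS hT x∈T x∉S λ z∈T z∉S →
      case within z∈T z∉S of λ { (inj₁ z≡x) → inj₁ z≡x ; (inj₂ (here refl)) → clash z∈T a?T ; (inj₂ (there z∈l)) → inj₂ z∈l }
    ... | no _ | true | true = exchange⁺-within l hS hT x∈T x∉S λ z∈T z∉S →
      case within z∈T z∉S of λ { (inj₁ z≡x) → inj₁ z≡x ; (inj₂ (here refl)) → clash a?S z∉S ; (inj₂ (there z∈l)) → inj₂ z∈l }
    ... | no a≢x | true | false with ex T S _ hT hS a?T a?S
    ...   | y , y∈S , y∉T , hT′ with exchange⁺-within l {T = T′} hS hT′ x∈T′ x∉S within′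
      where
      T′ = set (set T a false) y true

      unchanged : ∀ {z} → z ≢ a → z ≢ y → mem T′ z ≡ mem T z
      unchanged z≢a z≢y = trans (mem-set′ _ true z≢y) (mem-set′ T false z≢a)

      x∈T′ : mem T′ x ≡ true
      x∈T′ = trans (unchanged (a≢x ∘ sym) (separated x∈T y∉T)) x∈T

      a≢y : a ≢ y
      a≢y = separated a?T y∉T

      within′ : ∀ {z} → mem T′ z ≡ true → mem S z ≡ false → z ≡ x ⊎ z ∈ l
      within′ {z} z∈T′ z∉S with z ≟ a
      ... | yes refl = clash z∈T′ (trans (mem-set′ _ true a≢y) (mem-set T a false))
      ... | no z≢a with within (trans (sym (unchanged z≢a (separated y∈S z∉S ∘ sym))) z∈T′) z∉S
      ...   | inj₁ z≡x = inj₁ z≡x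
      ...   | inj₂ (here z≡a) = ⊥-elim (z≢a z≡a)
      ...   | inj₂ (there z∈l) = inj₂ z∈l
    ...     | z , z∈S , z∉T′ , hS′ = z , z∈S , trans (sym unchanged) z∉T′ , hS′
      where
      unchanged : mem (set (set T a false) y true) z ≡ mem T z
      unchanged = trans (mem-set′ _ true (separated (mem-set _ y true) z∉T′ ∘ sym))
        (mem-set′ T false (separated z∈S a?S))

    exchange⁺ : ∀ (L : List X) → (∀ x → x ∈ L) → Exchange⁺
    exchange⁺ L complete S T x hS hT x∈T x∉S = exchange⁺-within L hS hT x∈T x∉S (λ {z} _ _ → inj₂ (complete z))

  set-comm : ∀ S {x y} b c → x ≢ y → set (set S x b) y c ≡ set (set S y c) x b
  set-comm S {x} {y} b c x≢y = ext pointwise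
    where
    pointwise : ∀ z → mem (set (set S x b) y c) z ≡ mem (set (set S y c) x b) z
    pointwise z with z ≟ x | z ≟ y
    ... | yes refl | yes refl = ⊥-elim (x≢y refl)
    ... | yes refl | no z≢y = trans (mem-set′ _ c z≢y) (trans (mem-set S x b) (sym (mem-set _ x b)))
    ... | no z≢x | yes refl = trans (mem-set _ y c) (sym (trans (mem-set′ _ b z≢x) (mem-set S y c)))
    ... | no z≢x | no z≢y = trans (mem-set′ _ c z≢y) (trans (mem-set′ S b z≢x)
      (sym (trans (mem-set′ _ b z≢x) (mem-set′ S c z≢y))))

  set-idem : ∀ S {x} b → mem S x ≡ b → set S x b ≡ S
  set-idem S {x} b eq = ext pointwise
    where
    pointwise : ∀ z → mem (set S x b) z ≡ mem S z
    pointwise z with z ≟ x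
    ... | yes refl = trans (mem-set S x b) (sym eq)
    ... | no z≢x = mem-set′ S b z≢x

  set-set : ∀ S x b c → set (set S x b) x c ≡ set S x c
  set-set S x b c = ext pointwise
    where
    pointwise : ∀ z → mem (set (set S x b) x c) z ≡ mem (set S x c) z
    pointwise z with z ≟ x
    ... | yes refl = trans (mem-set _ x c) (sym (mem-set S x c))
    ... | no z≢x = trans (mem-set′ _ c z≢x) (trans (mem-set′ S b z≢x) (sym (mem-set′ S c z≢x)))

  -- True exactly when t has no repetition, is disjoint from S, and h holds of S ∪ t.
  extends : P → List X → Bool
  extends S [] = h S
  extends S (x ∷ t) = if mem S x then false else extends (set S x true) t

  adds : P → List X → P
  adds S [] = S
  adds S (x ∷ t) = adds (set S x true) t

  extends-∷⁻ : ∀ {S x} t → extends S (x ∷ t) ≡ true → mem S x ≡ false × extends (set S x true) t ≡ true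
  extends-∷⁻ {S} {x} t e with mem S x
  ... | false = refl , e

  extends-∷⁺ : ∀ {S x} t → mem S x ≡ false → extends (set S x true) t ≡ true → extends S (x ∷ t) ≡ true
  extends-∷⁺ {S} {x} t x∉S e with mem S x
  ... | false = e

  extends⇒h : ∀ S t → extends S t ≡ true → h (adds S t) ≡ true
  extends⇒h S [] e = e
  extends⇒h S (x ∷ t) e = extends⇒h (set S x true) t (proj₂ (extends-∷⁻ t e))

  extends-↭ : ∀ {s t} → s ↭ t → ∀ S → extends S s ≡ extends S t
  extends-↭ ↭.refl S = refl
  extends-↭ (prep x p) S = cong (if mem S x then false else_) (extends-↭ p (set S x true))
  extends-↭ (↭.trans p q) S = trans (extends-↭ p S) (extends-↭ q S)
  extends-↭ (swap {xs} {ys} x y p) S with x ≟ y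
  ... | yes refl = cong (λ e → if mem S x then false else if mem (set S x true) x then false else e) (extends-↭ p _)
  ... | no x≢y = trans (cong₂ (λ b e → if mem S x then false else if b then false else e)
      (mem-set′ S true (x≢y ∘ sym)) (trans (extends-↭ p _) (cong (λ T → extends T ys) (set-comm S true true x≢y))))
    (trans (if-comm (mem S x) (mem S y))
      (cong (λ b → if mem S y then false else if b then false else extends (set (set S y true) x true) ys)
        (sym (mem-set′ S true x≢y))))
    where
    if-comm : ∀ a b {e} → (if a then false else (if b then false else e)) ≡ (if b then false else (if a then false else e))
    if-comm true true = refl
    if-comm true false = refl
    if-comm false true = refl
    if-comm false false = refl

  adds-↭ : ∀ {s t} → s ↭ t → ∀ S → adds S s ≡ adds S t
  adds-↭ ↭.refl S = refl
  adds-↭ (prep x p) S = adds-↭ p _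
  adds-↭ (↭.trans p q) S = trans (adds-↭ p S) (adds-↭ q S)
  adds-↭ (swap {xs} {ys} x y p) S with x ≟ y
  ... | yes refl = adds-↭ p _
  ... | no x≢y = trans (adds-↭ p _) (cong (λ T → adds T ys) (set-comm S true true x≢y))

  mem-adds-⊇ : ∀ S t {x} → mem S x ≡ true → mem (adds S t) x ≡ true
  mem-adds-⊇ S [] x∈S = x∈S
  mem-adds-⊇ S (a ∷ t) {x} x∈S with x ≟ a
  ... | yes refl = mem-adds-⊇ _ t (mem-set S a true)
  ... | no x≢a = mem-adds-⊇ _ t (trans (mem-set′ S true x≢a) x∈S)

  mem-adds⁺ : ∀ S {t x} → x ∈ t → mem (adds S t) x ≡ true
  mem-adds⁺ S {a ∷ t} (here refl) = mem-adds-⊇ _ t (mem-set S a true)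
  mem-adds⁺ S {a ∷ t} (there x∈t) = mem-adds⁺ _ x∈t

  mem-adds⁻ : ∀ S t {x} → mem (adds S t) x ≡ true → mem S x ≡ true ⊎ x ∈ t
  mem-adds⁻ S [] e = inj₁ e
  mem-adds⁻ S (a ∷ t) {x} e with mem-adds⁻ (set S a true) t e | x ≟ a
  ... | inj₂ x∈t | _ = inj₂ (there x∈t)
  ... | inj₁ _ | yes refl = inj₂ (here refl)
  ... | inj₁ x∈S | no x≢a = inj₁ (trans (sym (mem-set′ S true x≢a)) x∈S)

  extends-disjoint : ∀ {S} t {x} → extends S t ≡ true → mem S x ≡ true → x ∉ t
  extends-disjoint {S} (a ∷ t) e x∈S (here refl) = clash x∈S (proj₁ (extends-∷⁻ t e))
  extends-disjoint {S} (a ∷ t) {x} e x∈S (there x∈t) with x ≟ a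
  ... | yes refl = clash x∈S (proj₁ (extends-∷⁻ t e))
  ... | no x≢a = extends-disjoint t (proj₂ (extends-∷⁻ t e)) (trans (mem-set′ S true x≢a) x∈S) x∈t

  adds-set : ∀ S t {x} b → x ∉ t → adds (set S x b) t ≡ set (adds S t) x b
  adds-set S [] b x∉t = refl
  adds-set S (a ∷ t) {x} b x∉t = trans (cong (λ T → adds T t) (set-comm S b true (x∉t ∘ here)))
    (adds-set (set S a true) t b (x∉t ∘ there))

  -- Absence of repetitions is inherited from `S`, and disjointness from `T` follows because `t`
  -- already avoids `S`.
  extends-transfer : ∀ t {S T} → extends S t ≡ true → (∀ {x} → x ∈ t → mem S x ≡ false → mem T x ≡ false) →
    h (adds T t) ≡ true → extends T t ≡ true
  extends-transfer [] e avoid hT = hT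
  extends-transfer (a ∷ t) {S} {T} e avoid hT =
    extends-∷⁺ t (avoid (here refl) (proj₁ (extends-∷⁻ t e))) (extends-transfer t (proj₂ (extends-∷⁻ t e)) avoid′ hT)
    where
    avoid′ : ∀ {x} → x ∈ t → mem (set S a true) x ≡ false → mem (set T a true) x ≡ false
    avoid′ {x} x∈t x∉S with x ≟ a
    ... | yes refl = clash (mem-set S a true) x∉S
    ... | no x≢a = trans (mem-set′ T true x≢a) (avoid (there x∈t) (trans (sym (mem-set′ S true x≢a)) x∉S))

  ∈⇒↭ : ∀ {x : X} {t} → x ∈ t → ∃[ u ] t ↭ x ∷ u
  ∈⇒↭ x∈t with ∈-∃++ x∈t
  ... | u , v , refl = u ++ v , ↭-shift _ u v

  module _ (ex : Exchange⁺) where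
    -- If `j` occurs in `t`, a permutation suffices. Otherwise insertion is applied to the two
    -- unions with `S`: the element given up lies outside the second union, hence not in `S`, hence
    -- in `t`.
    replace : ∀ {S} t u {j} → extends S t ≡ true → extends S (j ∷ u) ≡ true →
      ∃[ y ] ∃[ v ] (t ↭ y ∷ v × extends S (j ∷ v) ≡ true)
    replace {S} t u {j} et eju with mem (adds S t) j in j?t
    ... | true with mem-adds⁻ S t j?t
    ...   | inj₁ j∈S = clash j∈S (proj₁ (extends-∷⁻ u eju))
    ...   | inj₂ j∈t with ∈⇒↭ j∈t
    ...     | v , p = j , v , p , trans (sym (extends-↭ p S)) et
    replace {S} t u {j} et eju | false
      with ex _ _ j (extends⇒h S t et) (extends⇒h S (j ∷ u) eju) (mem-adds⁺ S {j ∷ u} (here refl)) j?t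
    ... | y , y∈t⁺ , y∉u⁺ , hyj with mem-adds⁻ S t y∈t⁺
    ...   | inj₁ y∈S = clash (mem-adds-⊇ S (j ∷ u) y∈S) y∉u⁺
    ...   | inj₂ y∈t with ∈⇒↭ y∈t
    ...     | v , p = y , v , p , extends-∷⁺ v (proj₁ (extends-∷⁻ u eju)) (extends-transfer v eyv avoid hjv)
      where
      y∉S : mem S y ≡ false
      y∉S = proj₁ (extends-∷⁻ v (trans (sym (extends-↭ p S)) et))

      eyv : extends (set S y true) v ≡ true
      eyv = proj₂ (extends-∷⁻ v (trans (sym (extends-↭ p S)) et))

      y∉v : y ∉ v
      y∉v = extends-disjoint v eyv (mem-set S y true)

      j∉v : j ∉ v
      j∉v j∈v = clash (mem-adds⁺ S (∈-resp-↭ (↭-sym p) (there j∈v))) j?t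

      avoid : ∀ {x} → x ∈ v → mem (set S y true) x ≡ false → mem (set S j true) x ≡ false
      avoid {x} x∈v x∉Sy with x ≟ j | x ≟ y
      ... | yes refl | _ = ⊥-elim (j∉v x∈v)
      ... | no x≢j | yes refl = ⊥-elim (y∉v x∈v)
      ... | no x≢j | no x≢y = trans (mem-set′ S true x≢j) (trans (sym (mem-set′ S true x≢y)) x∉Sy)

      y∉adds : mem (adds S v) y ≡ false
      y∉adds with mem (adds S v) y in eq
      ... | false = refl
      ... | true with mem-adds⁻ S v eq
      ...   | inj₁ y∈S = clash y∈S y∉S
      ...   | inj₂ y∈v = ⊥-elim (y∉v y∈v)

      removed : set (adds S t) y false ≡ adds S v
      removed = trans (cong (λ T → set T y false) (trans (adds-↭ p S) (adds-set S v true y∉v)))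
        (trans (set-set (adds S v) y true false) (set-idem (adds S v) false y∉adds))

      hjv : h (adds (set S j true) v) ≡ true
      hjv = trans (cong h (trans (adds-set S v true j∉v) (cong (λ T → set T j true) (sym removed)))) hyj

    -- The prefix is absorbed into `S`. Then `j` replaces a single entry: if that entry is `i`, then
    -- `k` survives, and otherwise `i` does.
    extends-exchange : ∀ s S {i k j t u} → extends S (s ++ i ∷ k ∷ t) ≡ true → extends S (s ++ j ∷ u) ≡ true →
      ∃[ v ] (length v ≡ length t × (extends S (s ++ i ∷ j ∷ v) ≡ true ⊎ extends S (s ++ k ∷ j ∷ v) ≡ true))
    extends-exchange (a ∷ s) S {i} {k} {j} {t} {u} e₁ e₂
      with extends-∷⁻ (s ++ i ∷ k ∷ t) e₁ | extends-∷⁻ (s ++ j ∷ u) e₂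
    ... | a∉S , e₁′ | _ , e₂′ with extends-exchange s (set S a true) {t = t} {u} e₁′ e₂′
    ...   | v , len , inj₁ e = v , len , inj₁ (extends-∷⁺ (s ++ i ∷ j ∷ v) a∉S e)
    ...   | v , len , inj₂ e = v , len , inj₂ (extends-∷⁺ (s ++ k ∷ j ∷ v) a∉S e)
    extends-exchange [] S {i} {k} {j} {t} {u} e₁ e₂ with replace (i ∷ k ∷ t) u e₁ e₂
    ... | y , w , p , ejw with ∈-resp-↭ p (here refl)
    ...   | here refl = t , refl , inj₂ (trans (extends-↭ (↭-trans (swap k j ↭-refl) (prep j (drop-∷ p))) S) ejw)
    ...   | there i∈w with ∈⇒↭ i∈w
    ...     | v , q = v , ℕ.suc-injective (ℕ.suc-injective (sym (↭-length (↭-trans p (prep y q)))))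
      , inj₁ (trans (extends-↭ (↭-trans (swap i j ↭-refl) (prep j (↭-sym q))) S) ejw)

    matroidLike : ∀ S → MatroidLike (extends S)
    matroidLike S = record
      { symmetric = λ p → extends-↭ p S
      ; irreflexive = irr
      ; exchange = λ s {i} {k} {j} {t} {u} → extends-exchange s S {i} {k} {j} {t} {u} }
      where
      irr : ∀ i t → extends S (i ∷ i ∷ t) ≡ false
      irr i t with mem S i
      ... | true = refl
      ... | false = cong (λ b → if b then false else extends (set (set S i true) i true) t) (mem-set S i true)

-- Bases of a bimatroid

∪-⁅⁆ : ∀ {n} (p : Subset n) i → p ∪ ⁅ i ⁆ ≡ p [ i ]≔ true
∪-⁅⁆ (b ∷ p) zero = cong₂ _∷_ (Bool.∨-zeroʳ b) (Subset.∪-identityʳ p)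
∪-⁅⁆ (b ∷ p) (suc i) = cong₂ _∷_ (Bool.∨-identityʳ b) (∪-⁅⁆ p i)

-≡[]≔ : ∀ {n} (p : Subset n) i → p Subset.- i ≡ p [ i ]≔ false
-≡[]≔ (b ∷ p) zero = cong (false ∷_) (Subset.p─⊥≡p p)
-≡[]≔ (b ∷ p) (suc i) = cong (b ∷_) (-≡[]≔ p i)

∁-[]≔ : ∀ {n} (p : Subset n) i b → ∁ (p [ i ]≔ b) ≡ ∁ p [ i ]≔ not b
∁-[]≔ p i b = Vec.map-[]≔ not p i

∈⇒lookup : ∀ {n} {p : Subset n} {i} → i Subset.∈ p → lookup p i ≡ true
∈⇒lookup = Vec.[]=⇒lookup

lookup⇒∈ : ∀ {n} {p : Subset n} {i} → lookup p i ≡ true → i Subset.∈ p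
lookup⇒∈ {p = p} {i} = Vec.lookup⇒[]= i p

∉⇒lookup : ∀ {n} {p : Subset n} {i} → i Subset.∉ p → lookup p i ≡ false
∉⇒lookup {p = p} {i} i∉p = Bool.¬-not (i∉p ∘ lookup⇒∈)

lookup⇒∉ : ∀ {n} {p : Subset n} {i} → lookup p i ≡ false → i Subset.∉ p
lookup⇒∉ eq i∈p = case trans (sym eq) (∈⇒lookup i∈p) of λ ()

module BiSubset {m n : ℕ} where
  Ground : Set
  Ground = Fin m ⊎ Fin n

  Pair : Set
  Pair = Subset m × Subset n

  _≟_ : DecidableEquality Ground
  _≟_ = Sum.≡-dec Fin._≟_ Fin._≟_

  mem : Pair → Ground → Bool
  mem (I , K) (inj₁ i) = lookup I i
  mem (I , K) (inj₂ j) = lookup K j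

  set : Pair → Ground → Bool → Pair
  set (I , K) (inj₁ i) b = I [ i ]≔ b , K
  set (I , K) (inj₂ j) b = I , K [ j ]≔ b

  lookup-ext : ∀ {k} {p q : Subset k} → (∀ i → lookup p i ≡ lookup q i) → p ≡ q
  lookup-ext eq = trans (sym (Vec.tabulate∘lookup _)) (trans (Vec.tabulate-cong eq) (Vec.tabulate∘lookup _))

  ext : ∀ {S T} → (∀ x → mem S x ≡ mem T x) → S ≡ T
  ext eq = cong₂ _,_ (lookup-ext (eq ∘ inj₁)) (lookup-ext (eq ∘ inj₂))

  mem-set : ∀ S x b → mem (set S x b) x ≡ b
  mem-set (I , K) (inj₁ i) b = Vec.lookup∘update i I b
  mem-set (I , K) (inj₂ j) b = Vec.lookup∘update j K b

  mem-set′ : ∀ S {x y} b → y ≢ x → mem (set S x b) y ≡ mem S y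
  mem-set′ (I , K) {inj₁ i} {inj₁ i′} b ne = Vec.lookup∘update′ (ne ∘ cong inj₁) I b
  mem-set′ (I , K) {inj₁ i} {inj₂ j} b ne = refl
  mem-set′ (I , K) {inj₂ j} {inj₁ i} b ne = refl
  mem-set′ (I , K) {inj₂ j} {inj₂ j′} b ne = Vec.lookup∘update′ (ne ∘ cong inj₂) K b

  module System = SetSystem _≟_ mem ext set mem-set mem-set′

-- The two families of bases of a bimatroid: I ∪ (F ∖ J), of rank |F|, and (E ∖ I) ∪ J, of rank |E|.
module Bases {m n : ℕ} (A : Bimatroid m n) where
  open Bimatroid A
  open BiSubset {m} {n}

  basesF basesE : Pair → Bool
  basesF (I , K) = R I (∁ K)
  basesE (K , J) = R (∁ K) J

  fromT : ∀ {b} → T b → b ≡ true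
  fromT {true} _ = refl

  toT : ∀ {b} → b ≡ true → T b
  toT refl = _

  ∈∁⇒ : ∀ {k} {p : Subset k} {i} → i Subset.∈ ∁ p → lookup p i ≡ false
  ∈∁⇒ i∈ = ∉⇒lookup (Subset.x∈∁p⇒x∉p i∈)

  ∉∁⇒ : ∀ {k} {p : Subset k} {i} → i Subset.∉ ∁ p → lookup p i ≡ true
  ∉∁⇒ i∉ = ∈⇒lookup (Subset.x∉∁p⇒x∈p i∉)

  ⇒∈∁ : ∀ {k} {p : Subset k} {i} → lookup p i ≡ false → i Subset.∈ ∁ p
  ⇒∈∁ eq = Subset.x∉p⇒x∈∁p (lookup⇒∉ eq)

  ⇒∉∁ : ∀ {k} {p : Subset k} {i} → lookup p i ≡ true → i Subset.∉ ∁ p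
  ⇒∉∁ eq = Subset.x∈p⇒x∉∁p (lookup⇒∈ eq)

  swapped : ∀ {k} (p : Subset k) i j → (p Subset.- i) ∪ ⁅ j ⁆ ≡ (p [ i ]≔ false) [ j ]≔ true
  swapped p i j = trans (∪-⁅⁆ _ j) (cong (_[ j ]≔ true) (-≡[]≔ p i))

  distinct : ∀ {k} {p : Subset k} {i j} → lookup p i ≡ true → lookup p j ≡ false → i ≢ j
  distinct i∈p j∉p refl = case trans (sym i∈p) j∉p of λ ()

  ∁-swapped : ∀ {k} (p : Subset k) {i j} → i ≢ j → (∁ p Subset.- j) ∪ ⁅ i ⁆ ≡ ∁ ((p [ i ]≔ false) [ j ]≔ true)
  ∁-swapped p {i} {j} i≢j = trans (swapped (∁ p) j i) (trans (Vec.[]≔-commutes (∁ p) j i (i≢j ∘ sym))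
    (sym (trans (∁-[]≔ _ j true) (cong (_[ j ]≔ false) (∁-[]≔ p i false)))))

  ∁-added : ∀ {k} (p : Subset k) i → ∁ p ∪ ⁅ i ⁆ ≡ ∁ (p [ i ]≔ false)
  ∁-added p i = trans (∪-⁅⁆ (∁ p) i) (sym (∁-[]≔ p i false))

  ∁-removed : ∀ {k} (p : Subset k) i → ∁ p Subset.- i ≡ ∁ (p [ i ]≔ true)
  ∁-removed p i = trans (-≡[]≔ (∁ p) i) (sym (∁-[]≔ p i true))

  R-cong : ∀ {I I′ J J′} → I ≡ I′ → J ≡ J′ → T (R I J) → R I′ J′ ≡ true
  R-cong refl refl r = fromT r

  -- The row axiom inserts an element of E; the column axiom deletes from J and so inserts into its
  -- complement. The alternatives of each axiom tell whether the element given up lies on the same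
  -- side or on the other.
  basesF-exchange : System.Exchange⁺ basesF
  basesF-exchange (I , K) (I′ , K′) (inj₁ i′) hS hT i′∈I′ i′∉I
    with exchangeRow I (∁ K) I′ (∁ K′) (toT hS) (toT hT) i′ (lookup⇒∈ i′∈I′) (lookup⇒∉ i′∉I)
  ... | inj₁ (i , i∈I , i∉I′ , r) = inj₁ i , ∈⇒lookup i∈I , ∉⇒lookup i∉I′ , R-cong (swapped I i i′) refl r
  ... | inj₂ (j , j∈J′ , j∉J , r) = inj₂ j , ∉∁⇒ j∉J , ∈∁⇒ j∈J′ , R-cong (∪-⁅⁆ I i′) (∁-added K j) r
  basesF-exchange (I , K) (I′ , K′) (inj₂ j) hS hT j∈K′ j∉K
    with exchangeCol I (∁ K) I′ (∁ K′) (toT hS) (toT hT) j (⇒∈∁ j∉K) (⇒∉∁ j∈K′)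
  ... | inj₁ (j′ , j′∈J′ , j′∉J , r) = inj₂ j′ , ∉∁⇒ j′∉J , ∈∁⇒ j′∈J′
    , R-cong refl (∁-swapped K (distinct {p = K} (∉∁⇒ j′∉J) j∉K)) r
  ... | inj₂ (i , i∈I , i∉I′ , r) = inj₁ i , ∈⇒lookup i∈I , ∉⇒lookup i∉I′ , R-cong (-≡[]≔ I i) (∁-removed K j) r

  -- These are the complements of the bases in the other family, as in the dual matroid.
  -- Complementation reverses insertion and deletion, so the same axioms give the deletion form.
  basesE-exchange⁻ : System.Exchange⁻ basesE
  basesE-exchange⁻ (K , J) (K′ , J′) (inj₁ i′) hS hT i′∈K i′∉K′
    with exchangeRow (∁ K) J (∁ K′) J′ (toT hS) (toT hT) i′ (⇒∈∁ i′∉K′) (⇒∉∁ i′∈K)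
  ... | inj₁ (i , i∈I , i∉I′ , r) = inj₁ i , ∉∁⇒ i∉I′ , ∈∁⇒ i∈I
    , R-cong (∁-swapped K (distinct {p = K} i′∈K (∈∁⇒ i∈I))) refl r
  ... | inj₂ (j , j∈J′ , j∉J , r) = inj₂ j , ∈⇒lookup j∈J′ , ∉⇒lookup j∉J , R-cong (∁-added K i′) (∪-⁅⁆ J j) r
  basesE-exchange⁻ (K , J) (K′ , J′) (inj₂ j) hS hT j∈J j∉J′
    with exchangeCol (∁ K) J (∁ K′) J′ (toT hS) (toT hT) j (lookup⇒∈ j∈J) (lookup⇒∉ j∉J′)
  ... | inj₁ (j′ , j′∈J′ , j′∉J , r) = inj₂ j′ , ∈⇒lookup j′∈J′ , ∉⇒lookup j′∉J , R-cong refl (swapped J j j′) r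
  ... | inj₂ (i , i∈I , i∉I′ , r) = inj₁ i , ∉∁⇒ i∉I′ , ∈∁⇒ i∈I , R-cong (∁-removed K i) (-≡[]≔ J j) r

  basesE-exchange : (L : List Ground) → (∀ x → x ∈ L) → System.Exchange⁺ basesE
  basesE-exchange = System.exchange⁺ basesE basesE-exchange⁻

-- Counting

module SubsetSums where
  open OrderedField
  open Summation

  unless : Bool → ℚ → ℚ
  unless b x = if b then 0ℚ else x

  unless-*ˡ : ∀ c b x → c * unless b x ≡ unless b (c * x)
  unless-*ˡ c true x = zeroʳ c
  unless-*ˡ c false x = refl

  ∑-unless : ∀ {X : Set} (L : List X) b f → ∑ L (λ x → unless b (f x)) ≡ unless b (∑ L f)
  ∑-unless L true f = ∑-zero L
  ∑-unless L false f = refl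

  ∑-allFin-suc : ∀ n (f : Fin (suc n) → ℚ) → ∑ (allFin (suc n)) f ≡ f zero + ∑ (allFin n) (f ∘ suc)
  ∑-allFin-suc n f = cong (f zero +_) (trans (cong (λ L → ∑ L f) (sym (map-tabulate id suc))) (∑-map suc (allFin n) f))

  ∑-allSubsets-suc : ∀ n (f : Subset (suc n) → ℚ) →
    ∑ (allSubsets (suc n)) f ≡ ∑ (allSubsets n) (f ∘ (true ∷_)) + ∑ (allSubsets n) (f ∘ (false ∷_))
  ∑-allSubsets-suc n f = trans (∑-++ (map (true ∷_) (allSubsets n)) _ f)
    (cong₂ _+_ (∑-map (true ∷_) (allSubsets n) f) (∑-map (false ∷_) (allSubsets n) f))

  extensions : ∀ {n} → (Subset n → ℚ) → Subset n → ℚ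
  extensions {n} f I = ∑ (allFin n) (λ i → unless (lookup I i) (f (I [ i ]≔ true)))

  -- A set arises by adding an element once for each of its members. In the induction `S` collects
  -- the extensions that add the first element of the ground set.
  double-count : ∀ n f → ∑ (allSubsets n) (extensions f) ≡ ∑ (allSubsets n) (λ I → fromℕ ∣ I ∣ * f I)
  double-count zero f = cong (_+ 0ℚ) (sym (zeroˡ (f [])))
  double-count (suc n) f = begin
    ∑ (allSubsets (suc n)) (extensions f)
      ≡⟨ ∑-allSubsets-suc n _ ⟩
    ∑ (allSubsets n) (λ I → extensions f (true ∷ I)) + ∑ (allSubsets n) (λ I → extensions f (false ∷ I))
      ≡⟨ cong₂ _+_ (trans (∑-cong (allSubsets n) (λ I → trans (∑-allFin-suc n _) (+-identityˡ _))) (double-count n (f ∘ (true ∷_))))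
           (trans (∑-cong (allSubsets n) (λ I → ∑-allFin-suc n _)) (trans (∑-+ (allSubsets n) _ _)
             (cong (S +_) (double-count n (f ∘ (false ∷_)))))) ⟩
    a + (S + b)
      ≡⟨ solve 3 (λ a s b → a :+ (s :+ b) := (s :+ a) :+ b) refl a S b ⟩
    (S + a) + b
      ≡⟨ cong (_+ b) (trans (sym (∑-+ (allSubsets n) _ _)) (∑-cong (allSubsets n)
           (λ I → solve 2 (λ k x → x :+ k :* x := (con 1ℚ :+ k) :* x) refl (fromℕ ∣ I ∣) (f (true ∷ I))))) ⟩
    ∑ (allSubsets n) (λ I → fromℕ ∣ true ∷ I ∣ * f (true ∷ I)) + ∑ (allSubsets n) (λ I → fromℕ ∣ false ∷ I ∣ * f (false ∷ I))
      ≡⟨ sym (∑-allSubsets-suc n _) ⟩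
    ∑ (allSubsets (suc n)) (λ I → fromℕ ∣ I ∣ * f I) ∎
    where
    open ≡-Reasoning
    S = ∑ (allSubsets n) (f ∘ (true ∷_))
    a = ∑ (allSubsets n) (λ I → fromℕ ∣ I ∣ * f (true ∷ I))
    b = ∑ (allSubsets n) (λ I → fromℕ ∣ I ∣ * f (false ∷ I))

  δ : ∀ {n} → ℕ → Subset n → ℚ
  δ k I = indicator (∣ I ∣ ≡ᵇ k)

  size-added : ∀ {n} (I : Subset n) i → lookup I i ≡ false → ∣ I [ i ]≔ true ∣ ≡ suc ∣ I ∣
  size-added (false ∷ I) zero eq = refl
  size-added (true ∷ I) (suc i) eq = cong suc (size-added I i eq)
  size-added (false ∷ I) (suc i) eq = size-added I i eq

  level : ∀ {n} → ℕ → (Subset n → ℚ) → ℚ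
  level {n} k f = ∑ (allSubsets n) (λ I → δ k I * f I)

  level-extensions : ∀ {n} k (f : Subset n → ℚ) → level k (extensions f) ≡ fromℕ (suc k) * level (suc k) f
  level-extensions {n} k f = begin
    level k (extensions f)
      ≡⟨ ∑-cong (allSubsets n) (λ I → trans (sym (∑-*ˡ (allFin n) _ _)) (∑-cong (allFin n) (λ i → added I i))) ⟩
    ∑ (allSubsets n) (extensions (λ I → δ (suc k) I * f I))
      ≡⟨ double-count n _ ⟩
    ∑ (allSubsets n) (λ I → fromℕ ∣ I ∣ * (δ (suc k) I * f I))
      ≡⟨ trans (∑-cong (allSubsets n) sized) (∑-*ˡ (allSubsets n) _ _) ⟩
    fromℕ (suc k) * level (suc k) f ∎
    where
    open ≡-Reasoning
    added : ∀ I i → δ k I * unless (lookup I i) (f (I [ i ]≔ true)) ≡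
      unless (lookup I i) (δ (suc k) (I [ i ]≔ true) * f (I [ i ]≔ true))
    added I i with lookup I i in eq
    ... | true = zeroʳ (δ k I)
    ... | false = cong (λ s → indicator (s ≡ᵇ suc k) * f (I [ i ]≔ true)) (sym (size-added I i eq))

    sized : ∀ I → fromℕ ∣ I ∣ * (δ (suc k) I * f I) ≡ fromℕ (suc k) * (δ (suc k) I * f I)
    sized I with ∣ I ∣ ≡ᵇ suc k in eq
    ... | true = cong (λ s → fromℕ s * (1ℚ * f I)) (ℕ.≡ᵇ⇒≡ ∣ I ∣ (suc k) (subst T (sym eq) _))
    ... | false = solve 3 (λ a b x → a :* (con 0ℚ :* x) := b :* (con 0ℚ :* x)) refl (fromℕ ∣ I ∣) (fromℕ (suc k)) (f I)

  level-zero : ∀ {n} (f : Subset n → ℚ) → level 0 f ≡ f Subset.⊥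
  level-zero {zero} f = solve 1 (λ x → con 1ℚ :* x :+ con 0ℚ := x) refl (f [])
  level-zero {suc n} f = trans (∑-allSubsets-suc n _) (trans (cong₂ _+_
    (trans (∑-cong (allSubsets n) (λ I → zeroˡ _)) (∑-zero (allSubsets n))) (level-zero (f ∘ (false ∷_)))) (+-identityˡ _))

  level-cong : ∀ {n} k {f g : Subset n → ℚ} → (∀ I → f I ≡ g I) → level k f ≡ level k g
  level-cong {n} k eq = ∑-cong (allSubsets n) (λ I → cong (δ k I *_) (eq I))

  level-*ˡ : ∀ {n} k c (f : Subset n → ℚ) → level k (λ I → c * f I) ≡ c * level k f
  level-*ˡ {n} k c f = trans
    (∑-cong (allSubsets n) (λ I → solve 3 (λ d c x → d :* (c :* x) := c :* (d :* x)) refl (δ k I) c (f I)))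
    (∑-*ˡ (allSubsets n) c _)

  level-∑ : ∀ {n} {X : Set} k (L : List X) (f : X → Subset n → ℚ) → level k (λ I → ∑ L (λ x → f x I)) ≡ ∑ L (λ x → level k (f x))
  level-∑ {n} k L f = trans (∑-cong (allSubsets n) (λ I → sym (∑-*ˡ L (δ k I) (λ x → f x I)))) (∑-swap (allSubsets n) L _)

  level-unless : ∀ {n} k b (f : Subset n → ℚ) → level k (λ I → unless b (f I)) ≡ unless b (level k f)
  level-unless {n} k b f = trans (∑-cong (allSubsets n) (λ I → unless-*ˡ (δ k I) b (f I))) (∑-unless (allSubsets n) b _)

  ∑-∁ : ∀ n (f : Subset n → ℚ) → ∑ (allSubsets n) (f ∘ ∁) ≡ ∑ (allSubsets n) f
  ∑-∁ zero f = refl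
  ∑-∁ (suc n) f = trans (∑-allSubsets-suc n (f ∘ ∁)) (trans (+-comm _ _)
    (trans (cong₂ _+_ (∑-∁ n (f ∘ (true ∷_))) (∑-∁ n (f ∘ (false ∷_)))) (sym (∑-allSubsets-suc n f))))

  size-∁ : ∀ {n} (p : Subset n) → ∣ p ∣ ℕ.+ ∣ ∁ p ∣ ≡ n
  size-∁ [] = refl
  size-∁ (true ∷ p) = cong suc (size-∁ p)
  size-∁ (false ∷ p) = trans (ℕ.+-suc ∣ p ∣ ∣ ∁ p ∣) (cong suc (size-∁ p))

  ≡ᵇ-∸ : ∀ {a b k l} → a ℕ.+ b ≡ k ℕ.+ l → (b ≡ᵇ l) ≡ (a ≡ᵇ k)
  ≡ᵇ-∸ {zero} {b} {zero} {l} refl = ≡ᵇ-refl b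
    where
    ≡ᵇ-refl : ∀ b → (b ≡ᵇ b) ≡ true
    ≡ᵇ-refl zero = refl
    ≡ᵇ-refl (suc b) = ≡ᵇ-refl b
  ≡ᵇ-∸ {suc a} {b} {suc k} {l} eq = ≡ᵇ-∸ {a} {b} {k} {l} (ℕ.suc-injective eq)
  ≡ᵇ-∸ {suc a} {b} {zero} {l} eq = Bool.¬-not (λ t → ℕ.<⇒≢ (ℕ.m<n+m b {suc a} ℕ.z<s) (trans (ℕ.≡ᵇ⇒≡ b l (subst T (sym t) _)) (sym eq)))
  ≡ᵇ-∸ {zero} {b} {suc k} {l} eq = Bool.¬-not (λ t → ℕ.<⇒≢ (ℕ.m<n+m l {suc k} ℕ.z<s) (trans (sym (ℕ.≡ᵇ⇒≡ b l (subst T (sym t) _))) eq))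

  level-∁ : ∀ {n k l} → k ℕ.+ l ≡ n → (f : Subset n → ℚ) → level l (f ∘ ∁) ≡ level k f
  level-∁ {n} {k} {l} refl f = trans (sym (∑-∁ n _)) (∑-cong (allSubsets n) (λ I →
    cong₂ (λ b J → indicator b * f J) (≡ᵇ-∸ {∣ I ∣} {∣ ∁ I ∣} {k} {l} (size-∁ I)) (∁-involutive I)))
    where
    ∁-involutive : ∀ {n} (p : Subset n) → ∁ (∁ p) ≡ p
    ∁-involutive [] = refl
    ∁-involutive (b ∷ p) = cong₂ _∷_ (Bool.not-involutive b) (∁-involutive p)

  ∑-filter : ∀ {X : Set} {p} {P : Pred X p} (P? : Decidable P) L → fromℕ (length (filter P? L)) ≡ ∑ L (λ x → indicator (does (P? x)))
  ∑-filter P? [] = refl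
  ∑-filter P? (x ∷ L) with does (P? x)
  ... | true = cong (1ℚ +_) (∑-filter P? L)
  ... | false = trans (∑-filter P? L) (sym (+-identityˡ _))

  ∑-concatMap : ∀ {X Y : Set} (g : X → List Y) L f → ∑ (concatMap g L) f ≡ ∑ L (λ x → ∑ (g x) f)
  ∑-concatMap g [] f = refl
  ∑-concatMap g (x ∷ L) f = trans (∑-++ (g x) _ f) (cong (∑ (g x) f +_) (∑-concatMap g L f))

  count : ∀ {m n} (A : Bimatroid m n) k →
    fromℕ (regularCount A k) ≡ level k (λ I → level k (λ J → indicator (Bimatroid.R A I J)))
  count {m} {n} A k = begin
    fromℕ (regularCount A k)
      ≡⟨ cong fromℕ (proj₂ unfolded) ⟩
    fromℕ (length (filter (λ p → Bool.T? (regular p)) pairs))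
      ≡⟨ ∑-filter (λ p → Bool.T? (regular p)) pairs ⟩
    ∑ pairs (indicator ∘ regular)
      ≡⟨ ∑-concatMap (λ I → map (I ,_) (allSubsets n)) (allSubsets m) _ ⟩
    ∑ (allSubsets m) (λ I → ∑ (map (I ,_) (allSubsets n)) (indicator ∘ regular))
      ≡⟨ ∑-cong (allSubsets m) (λ I → trans (∑-map (I ,_) (allSubsets n) _)
           (trans (∑-cong (allSubsets n) (term I)) (∑-*ˡ (allSubsets n) (δ k I) _))) ⟩
    level k (λ I → level k (λ J → indicator (Bimatroid.R A I J))) ∎
    where
    open ≡-Reasoning
    pairs : List (Subset m × Subset n)
    pairs = concatMap (λ I → map (I ,_) (allSubsets n)) (allSubsets m)

    -- Names the characteristic function hidden in the definition of regularCount.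
    unfolded : Σ (Subset m × Subset n → Bool) λ b →
      regularCount A k ≡ length (filter {P = λ p → T (b p)} (λ p → Bool.T? (b p)) pairs)
    unfolded = _ , refl

    regular : Subset m × Subset n → Bool
    regular = proj₁ unfolded

    term : ∀ I J → indicator (regular (I , J)) ≡ δ k I * (δ k J * indicator (Bimatroid.R A I J))
    term I J with Bimatroid.R A I J | ∣ I ∣ ≡ᵇ k | ∣ J ∣ ≡ᵇ k
    ... | true | true | true = solve 0 (con 1ℚ := con 1ℚ :* (con 1ℚ :* con 1ℚ)) refl
    ... | true | true | false = solve 0 (con 0ℚ := con 1ℚ :* (con 0ℚ :* con 1ℚ)) refl
    ... | true | false | b = solve 1 (λ b → con 0ℚ := con 0ℚ :* (b :* con 1ℚ)) refl (indicator b)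
    ... | false | a | b = solve 2 (λ a b → con 0ℚ := a :* (b :* con 0ℚ)) refl (indicator a) (indicator b)

module TaggedCount {m n : ℕ} where
  open OrderedField
  open Summation
  open SubsetSums using (unless; extensions; level; level-extensions; level-zero; level-cong; level-*ˡ; level-∑; level-unless)
  open BiSubset {m} {n}

  elements : List Ground
  elements = map inj₁ (allFin m) ++ map inj₂ (allFin n)

  complete : ∀ x → x ∈ elements
  complete (inj₁ i) = ∈-++⁺ˡ (∈-map⁺ inj₁ (∈-allFin i))
  complete (inj₂ j) = ∈-++⁺ʳ (map inj₁ (allFin m)) (∈-map⁺ inj₂ (∈-allFin j))

  open Polarization elements complete

  -- The indicator vector of E for `true` and of F for `false`; a list of tags prescribes the side
  -- of each entry of a tuple.
  weight : Bool → Ground → ℚ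
  weight b (inj₁ _) = indicator b
  weight b (inj₂ _) = indicator (not b)

  trues falses : List Bool → ℕ
  trues [] = 0
  trues (true ∷ ts) = suc (trues ts)
  trues (false ∷ ts) = trues ts
  falses [] = 0
  falses (true ∷ ts) = falses ts
  falses (false ∷ ts) = suc (falses ts)

  ∑-weight-true : ∀ f → ∑ elements (λ x → weight true x * f x) ≡ ∑ (allFin m) (f ∘ inj₁)
  ∑-weight-true f = trans (∑-++ (map inj₁ (allFin m)) _ _) (trans (cong₂ _+_
    (trans (∑-map inj₁ (allFin m) _) (∑-cong (allFin m) (λ i → *-identityˡ _)))
    (trans (∑-map inj₂ (allFin n) _) (trans (∑-cong (allFin n) (λ j → zeroˡ _)) (∑-zero (allFin n))))) (+-identityʳ _))

  ∑-weight-false : ∀ f → ∑ elements (λ x → weight false x * f x) ≡ ∑ (allFin n) (f ∘ inj₂)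
  ∑-weight-false f = trans (∑-++ (map inj₁ (allFin m)) _ _) (trans (cong₂ _+_
    (trans (∑-map inj₁ (allFin m) _) (trans (∑-cong (allFin m) (λ i → zeroˡ _)) (∑-zero (allFin m))))
    (trans (∑-map inj₂ (allFin n) _) (∑-cong (allFin n) (λ j → *-identityˡ _)))) (+-identityˡ _))

  F-false : ∀ zs → F zs (λ _ → false) ≡ 0ℚ
  F-false [] = refl
  F-false (z ∷ zs) = trans (∑-cong elements (λ x → trans (cong (z x *_) (F-false zs)) (zeroʳ (z x)))) (∑-zero elements)

  F-unless : ∀ zs b φ → F zs (λ t → if b then false else φ t) ≡ unless b (F zs φ)
  F-unless zs true φ = F-false zs
  F-unless zs false φ = refl

  module _ (h : Pair → Bool) where
    open System h using (extends)

    -- The number of tuples, with sides prescribed by the tags, that extend `S` without repetition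
    -- to a member of `h`.
    V : List Bool → Pair → ℚ
    V ts S = F (map weight ts) (extends S)

    V-true : ∀ ts I K → V (true ∷ ts) (I , K) ≡ extensions (λ I → V ts (I , K)) I
    V-true ts I K = trans (∑-weight-true _) (∑-cong (allFin m) (λ i → F-unless (map weight ts) (lookup I i) _))

    V-false : ∀ ts I K → V (false ∷ ts) (I , K) ≡ extensions (λ K → V ts (I , K)) K
    V-false ts I K = trans (∑-weight-false _) (∑-cong (allFin n) (λ j → F-unless (map weight ts) (lookup K j) _))

    bilevel : ℕ → ℕ → (Pair → ℚ) → ℚ
    bilevel p q g = level p (λ I → level q (λ K → g (I , K)))

    bilevel-true : ∀ p q ts → bilevel p q (V (true ∷ ts)) ≡ fromℕ (suc p) * bilevel (suc p) q (V ts)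
    bilevel-true p q ts = trans (level-cong p (λ I → trans (level-cong q (λ K → V-true ts I K))
      (trans (level-∑ q (allFin m) (λ i K → unless (lookup I i) (V ts (I [ i ]≔ true , K))))
        (∑-cong (allFin m) (λ i → level-unless q (lookup I i) (λ K → V ts (I [ i ]≔ true , K)))))))
      (level-extensions p (λ I → level q (λ K → V ts (I , K))))

    bilevel-false : ∀ p q ts → bilevel p q (V (false ∷ ts)) ≡ fromℕ (suc q) * bilevel p (suc q) (V ts)
    bilevel-false p q ts = trans (level-cong p (λ I → trans (level-cong q (λ K → V-false ts I K))
      (level-extensions q (λ K → V ts (I , K))))) (level-*ˡ p (fromℕ (suc q)) (λ I → level (suc q) (λ K → V ts (I , K))))

    -- Each basis with p elements in E and q in F arises from p! q! ordered tuples.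
    bilevel-count : ∀ ts p q → fromℕ (p ! ℕ.* q !) * bilevel p q (V ts) ≡
      fromℕ ((p ℕ.+ trues ts) ! ℕ.* (q ℕ.+ falses ts) !) * bilevel (p ℕ.+ trues ts) (q ℕ.+ falses ts) (V [])
    bilevel-count [] p q rewrite ℕ.+-identityʳ p | ℕ.+-identityʳ q = refl
    bilevel-count (true ∷ ts) p q rewrite ℕ.+-suc p (trues ts) = trans
      (trans (cong (fromℕ (p ! ℕ.* q !) *_) (bilevel-true p q ts)) (trans (sym (*-assoc _ _ _))
        (cong (_* bilevel (suc p) q (V ts)) (trans (sym (fromℕ-* (p ! ℕ.* q !) (suc p))) (cong fromℕ
          (trans (ℕ.*-comm (p ! ℕ.* q !) (suc p)) (sym (ℕ.*-assoc (suc p) (p !) (q !)))))))))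
      (bilevel-count ts (suc p) q)
    bilevel-count (false ∷ ts) p q rewrite ℕ.+-suc q (falses ts) = trans
      (trans (cong (fromℕ (p ! ℕ.* q !) *_) (bilevel-false p q ts)) (trans (sym (*-assoc _ _ _))
        (cong (_* bilevel p (suc q) (V ts)) (trans (sym (fromℕ-* (p ! ℕ.* q !) (suc q))) (cong fromℕ
          (trans (ℕ.*-assoc (p !) (q !) (suc q)) (cong (p ! ℕ.*_) (ℕ.*-comm (q !) (suc q)))))))))
      (bilevel-count ts p (suc q))

    ordered-count : ∀ ts → V ts (Subset.⊥ , Subset.⊥) ≡
      fromℕ (trues ts ! ℕ.* falses ts !) * bilevel (trues ts) (falses ts) (indicator ∘ h)
    ordered-count ts = trans (sym (trans (cong (_* bilevel 0 0 (V ts)) (+-identityʳ 1ℚ)) (trans (*-identityˡ _) (trans (level-zero (λ I → level 0 (λ K → V ts (I , K)))) (level-zero (λ K → V ts (Subset.⊥ , K))))))) (bilevel-count ts 0 0)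

-- Ultra log-concavity of the numbers of regular minors

open import Data.Nat using (ℕ; suc; _*_; _⊓_; _≥_)
open import Data.Nat.Combinatorics using (_C_)

module LevelCounts {m n : ℕ} where
  open OrderedField hiding (_*_)
  open OrderedField using () renaming (_*_ to _·_)
  open SubsetSums
  open BiSubset {m} {n}
  open TaggedCount {m} {n}
  open Polarization elements complete
  open AlexandrovFenchel elements complete

  tags : ℕ → ℕ → List Bool
  tags k l = replicate k true ++ replicate l false

  trues-tags : ∀ k l → trues (tags k l) ≡ k
  trues-tags zero zero = refl
  trues-tags zero (suc l) = trues-tags zero l
  trues-tags (suc k) l = cong suc (trues-tags k l)

  falses-tags : ∀ k l → falses (tags k l) ≡ l
  falses-tags zero zero = refl
  falses-tags zero (suc l) = cong suc (falses-tags zero l)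
  falses-tags (suc k) l = falses-tags k l

  weight-nonneg : ∀ b → Nonneg (weight b)
  weight-nonneg b (inj₁ _) = indicator-nonneg b
  weight-nonneg b (inj₂ _) = indicator-nonneg (not b)

  weights-nonneg : ∀ ts → All Nonneg (map weight ts)
  weights-nonneg [] = []
  weights-nonneg (b ∷ ts) = weight-nonneg b ∷ weights-nonneg ts

  module _ (h : Pair → Bool) (ex : System.Exchange⁺ h) where
    ordered : ℕ → ℕ → ℚ
    ordered p q = fromℕ (p ! * q !) · bilevel h p q (indicator ∘ h)

    ordered-tags : ∀ ts {p q} → trues ts ≡ p → falses ts ≡ q → V h ts (Subset.⊥ , Subset.⊥) ≡ ordered p q
    ordered-tags ts refl refl = ordered-count h ts

    -- The Alexandrov-Fenchel inequality for the indicator vectors of E and F, with k copies of the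
    -- first and l of the second as remaining arguments.
    ordered-log-concave : ∀ k l → ordered (2 ℕ.+ k) l · ordered k (2 ℕ.+ l) ≤ ordered (suc k) (suc l) · ordered (suc k) (suc l)
    ordered-log-concave k l = subst₂ _≤_
      (cong₂ _·_ (ordered-tags (true ∷ true ∷ ts) (cong (2 ℕ.+_) eq₁) eq₂)
                 (ordered-tags (false ∷ false ∷ ts) eq₁ (cong (2 ℕ.+_) eq₂)))
      (cong (λ a → a · a) (ordered-tags (true ∷ false ∷ ts) (cong suc eq₁) (cong suc eq₂)))
      (polarized-log-concave (weight-nonneg true) (weight-nonneg false) (weights-nonneg ts)
        (System.matroidLike h ex (Subset.⊥ , Subset.⊥)))
      where
      ts = tags k l
      eq₁ = trues-tags k l
      eq₂ = falses-tags k l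

module RegularCounts {m n : ℕ} (A : Bimatroid m n) where
  open OrderedField hiding (_*_)
  open OrderedField using () renaming (_*_ to _·_)
  open Summation
  open SubsetSums
  open BiSubset {m} {n}
  open TaggedCount {m} {n}
  open LevelCounts {m} {n}
  open Bases A

  countF : ∀ {k l} → k ℕ.+ l ≡ n → ordered basesF basesF-exchange k l ≡ fromℕ (k ! * l ! * regularCount A k)
  countF {k} {l} k+l≡n = trans (cong (fromℕ (k ! * l !) ·_)
    (trans (level-cong k (λ I → level-∁ k+l≡n (λ J → indicator (Bimatroid.R A I J)))) (sym (count A k))))
    (sym (fromℕ-* (k ! * l !) (regularCount A k)))

  -- The sizes appear in the order `l`, `k` because a minor of size k gives a basis with m - k
  -- elements in E and k in F.
  countE : ∀ {k l} → k ℕ.+ l ≡ m → ordered basesE (basesE-exchange elements complete) l k ≡ fromℕ (k ! * l ! * regularCount A k)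
  countE {k} {l} k+l≡m = trans (cong₂ _·_ (cong fromℕ (ℕ.*-comm (l !) (k !)))
    (trans (level-∁ k+l≡m (λ I → level k (λ J → indicator (Bimatroid.R A I J)))) (sym (count A k))))
    (sym (fromℕ-* (k ! * l !) (regularCount A k)))

  fromℕ-cancel-squares : ∀ a b c → fromℕ a · fromℕ b ≤ fromℕ c · fromℕ c → a * b ℕ.≤ c * c
  fromℕ-cancel-squares a b c le =
    fromℕ-cancel-≤ (a * b) (c * c) (subst₂ _≤_ (sym (fromℕ-* a b)) (sym (fromℕ-* c c)) le)

  -- Of the two families of bases, the one whose rank is the minimum of m and n is used, so that the
  -- complementary sizes add up to that minimum.
  factorial-log-concave : ∀ k l → 2 ℕ.+ k ℕ.+ l ≡ m ⊓ n →
    ((2 ℕ.+ k) ! * l ! * regularCount A (2 ℕ.+ k)) * (k ! * (2 ℕ.+ l) ! * regularCount A k) ℕ.≤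
    (suc k ! * suc l ! * regularCount A (suc k)) * (suc k ! * suc l ! * regularCount A (suc k))
  factorial-log-concave k l eq = [ rows , columns ]′ (ℕ.≤-total m n)
    where
    r₀ = k ! * (2 ℕ.+ l) ! * regularCount A k
    r₁ = suc k ! * suc l ! * regularCount A (suc k)
    r₂ = (2 ℕ.+ k) ! * l ! * regularCount A (2 ℕ.+ k)

    shift₁ : suc k ℕ.+ suc l ≡ 2 ℕ.+ k ℕ.+ l
    shift₁ = cong suc (ℕ.+-suc k l)

    shift₂ : k ℕ.+ (2 ℕ.+ l) ≡ 2 ℕ.+ k ℕ.+ l
    shift₂ = trans (ℕ.+-suc k (suc l)) shift₁

    rows : m ℕ.≤ n → r₂ * r₀ ℕ.≤ r₁ * r₁
    rows m≤n = fromℕ-cancel-squares r₂ r₀ r₁ (subst₂ _≤_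
      (trans (OrderedField.*-comm (ordered basesE ex (2 ℕ.+ l) k) (ordered basesE ex l (2 ℕ.+ k))) (cong₂ _·_ (countE eq′) (countE (trans shift₂ eq′))))
      (cong (λ a → a · a) (countE (trans shift₁ eq′)))
      (ordered-log-concave basesE ex l k))
      where
      ex : System.Exchange⁺ basesE
      ex = basesE-exchange elements complete

      eq′ = trans eq (ℕ.m≤n⇒m⊓n≡m m≤n)

    columns : n ℕ.≤ m → r₂ * r₀ ℕ.≤ r₁ * r₁
    columns n≤m = fromℕ-cancel-squares r₂ r₀ r₁ (subst₂ _≤_
      (cong₂ _·_ (countF eq′) (countF (trans shift₂ eq′)))
      (cong (λ a → a · a) (countF (trans shift₁ eq′)))
      (ordered-log-concave basesF basesF-exchange k l))
      where eq′ = trans eq (ℕ.m≥n⇒m⊓n≡n n≤m)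

  level-empty : ∀ {k r} → r ℕ.< k → (f : Subset r → ℚ) → level k f ≡ 0ℚ
  level-empty {k} {r} r<k f = trans (∑-cong (allSubsets r) (λ I → trans
    (cong (λ b → indicator b · f I) (Bool.¬-not {y = true} (λ t → ℕ.<⇒≢ (ℕ.≤-<-trans (Subset.∣p∣≤n I) r<k) (ℕ.≡ᵇ⇒≡ ∣ I ∣ k (subst T (sym t) _)))))
    (zeroˡ (f I)))) (∑-zero (allSubsets r))

  regularCount-empty : ∀ {k} → m ⊓ n ℕ.< k → regularCount A k ≡ 0
  regularCount-empty {k} lt = ℕ.n≤0⇒n≡0 (fromℕ-cancel-≤ (regularCount A k) 0 (≤-reflexive (trans (count A k)
    ([ (λ m≤n → level-empty (subst (ℕ._< k) (ℕ.m≤n⇒m⊓n≡m m≤n) lt) _)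
     , (λ n≤m → trans (level-cong {m} k (λ I → level-empty (subst (ℕ._< k) (ℕ.m≥n⇒m⊓n≡n n≤m) lt) _))
         (trans (∑-cong (allSubsets m) (λ I → zeroʳ (δ k I))) (∑-zero (allSubsets m)))) ]′
      (ℕ.≤-total m n)))))

binomial-factorials : ∀ {d} k l → k ℕ.+ l ≡ d → (d C k) * (k ! * l !) ≡ d !
binomial-factorials k l refl = subst (λ j → ((k ℕ.+ l) C k) * (k ! * j !) ≡ (k ℕ.+ l) !) (ℕ.m+n∸m≡n k l)
  (trans (cong (_* (k ! * (k ℕ.+ l ℕ.∸ k) !)) (nCk≡n!/k![n-k]! k≤k+l))
    (ℕ.m/n*n≡m {{k ℕ.!* (k ℕ.+ l ℕ.∸ k) !≢0}} (k![n∸k]!∣n! k≤k+l)))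
  where k≤k+l = ℕ.m≤m+n k l

-- Both sides are multiplied by N², where N is the common value of the cᵢ fᵢ.
clear-factorials : ∀ {N} .{{_ : ℕ.NonZero N}} c₀ c₁ c₂ f₀ f₁ f₂ r₀ r₁ r₂ → c₀ * f₀ ≡ N → c₁ * f₁ ≡ N → c₂ * f₂ ≡ N →
  (f₂ * r₂) * (f₀ * r₀) ℕ.≤ (f₁ * r₁) * (f₁ * r₁) → (r₂ * r₀) * (c₁ * c₁) ℕ.≤ (r₁ * r₁) * (c₂ * c₀)
clear-factorials {N} c₀ c₁ c₂ f₀ f₁ f₂ r₀ r₁ r₂ eq₀ eq₁ eq₂ le =
  ℕ.*-cancelʳ-≤ _ _ (N * N) {{ℕ.m*n≢0 N N}} (subst₂ ℕ._≤_ lhs rhs (ℕ.*-monoˡ-≤ ((c₁ * c₁) * (c₂ * c₀)) le))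
  where
  open +-*-Solver
  lhs : (f₂ * r₂) * (f₀ * r₀) * ((c₁ * c₁) * (c₂ * c₀)) ≡ (r₂ * r₀) * (c₁ * c₁) * (N * N)
  lhs = trans (solve 7 (λ c₀ c₁ c₂ f₀ f₂ r₀ r₂ → (f₂ :* r₂) :* (f₀ :* r₀) :* ((c₁ :* c₁) :* (c₂ :* c₀)) :=
      (r₂ :* r₀) :* (c₁ :* c₁) :* ((c₂ :* f₂) :* (c₀ :* f₀))) refl c₀ c₁ c₂ f₀ f₂ r₀ r₂)
    (cong₂ (λ a b → (r₂ * r₀) * (c₁ * c₁) * (a * b)) eq₂ eq₀)
  rhs : (f₁ * r₁) * (f₁ * r₁) * ((c₁ * c₁) * (c₂ * c₀)) ≡ (r₁ * r₁) * (c₂ * c₀) * (N * N)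
  rhs = trans (solve 5 (λ c₀ c₁ c₂ f₁ r₁ → (f₁ :* r₁) :* (f₁ :* r₁) :* ((c₁ :* c₁) :* (c₂ :* c₀)) :=
      (r₁ :* r₁) :* (c₂ :* c₀) :* ((c₁ :* f₁) :* (c₁ :* f₁))) refl c₀ c₁ c₂ f₁ r₁)
    (cong (λ a → (r₁ * r₁) * (c₂ * c₀) * (a * a)) eq₁)

theoremA : ∀ {m n : ℕ} (A : Bimatroid m n) (k : ℕ) →
    let R = regularCount A
        c = λ j → (m ⊓ n) C j
    in (R (suc k) * R (suc k)) * (c (suc (suc k)) * c k)
       ≥ (R (suc (suc k)) * R k) * (c (suc k) * c (suc k))
theoremA {m} {n} A k = [ interior , beyond ]′ (ℕ.≤-<-connex (2 ℕ.+ k) (m ⊓ n))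
  where
  open RegularCounts A
  R = regularCount A
  c = λ j → (m ⊓ n) C j

  interior : 2 ℕ.+ k ℕ.≤ m ⊓ n → (R (suc k) * R (suc k)) * (c (suc (suc k)) * c k) ≥ (R (suc (suc k)) * R k) * (c (suc k) * c (suc k))
  interior le = clear-factorials {{(m ⊓ n) ℕ.!≢0}} (c k) (c (suc k)) (c (2 ℕ.+ k))
    (k ! * (2 ℕ.+ l) !) (suc k ! * suc l !) ((2 ℕ.+ k) ! * l !) (R k) (R (suc k)) (R (2 ℕ.+ k))
    (binomial-factorials k (2 ℕ.+ l) (trans (ℕ.+-suc k (suc l)) (trans (cong suc (ℕ.+-suc k l)) eq)))
    (binomial-factorials (suc k) (suc l) (trans (cong suc (ℕ.+-suc k l)) eq))
    (binomial-factorials (2 ℕ.+ k) l eq)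
    (factorial-log-concave k l eq)
    where
    l = m ⊓ n ℕ.∸ (2 ℕ.+ k)
    eq : 2 ℕ.+ k ℕ.+ l ≡ m ⊓ n
    eq = ℕ.m+[n∸m]≡n le

  beyond : m ⊓ n ℕ.< 2 ℕ.+ k → (R (suc k) * R (suc k)) * (c (suc (suc k)) * c k) ≥ (R (suc (suc k)) * R k) * (c (suc k) * c (suc k))
  -- Here R at k + 2 is 0 and so is the smaller side; factorials could not be cleared, as the
  -- binomial at k + 2 vanishes too.
  beyond lt rewrite regularCount-empty lt = ℕ.z≤n
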